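{- There is an absolute constant $B>0$ such that for all integers $n\ge2$, $b\ge2$, $r\ge1$ with $c:=b^{2r}/n>1$ (i.e. $r=\frac12\log_b(nc)$), $$\|P^r_0-\pi\|_{TV}\le\frac{B}{\sqrt n}+\frac{B}{\sqrt c},$$ where $P^r_0$ is the distribution of the base-$b$ carries chain for adding $n$ numbers after $r$ steps started from $0$, and $\pi(j)=A(n,j)/n!$.
   Context: $A(n,j)$ is the number of permutations in $S_n$ with exactly $j$ descents. The base-$b$ carries chain for adding $n$ numbers is the Markov chain on $\{0,\dots,n-1\}$ given by $\kappa_0=0$, $\kappa_{t+1}=\lfloor(\kappa_t+X_{t+1,1}+\dots+X_{t+1,n})/b\rfloor$ with $X_{t,k}$ i.i.d. uniform on $\{0,\dots,b-1\}$. $\|P-Q\|_{TV}=\frac12\sum_x|P(x)-Q(x)|$. -}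

module Defs where

open import Data.Bool.Base using (if_then_else_)
open import Data.Fin.Base using (Fin; toℕ)
import Data.Fin.Properties as Fin
open import Data.Integer.Base using (+_)
open import Data.List.Base using (List; []; _∷_; [_]; allFin; cartesianProductWith; filter; length)
open import Data.Nat.Base
open import Data.Nat.DivMod using (_/_; m<n*o⇒m/o<n)
open import Data.Nat.Properties
open import Data.Product.Base using (_×_; _,_; ∃₂)
open import Data.Rational.Base as ℚ using (ℚ; 0ℚ; ½)
open import Data.Vec.Base as Vec using (Vec; []; _∷_)
open import Data.Vec.Relation.Unary.AllPairs using (allPairs?)
open import Data.Vec.Relation.Unary.Unique.Propositional using (Unique)
open import Relation.Binary.PropositionalEquality using (_≡_; cong)
open import Relation.Nullary using (does; ¬?; _×-dec_)
open import Relation.Unary using (Decidable)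
open import Algebra.Definitions.RawMonoid ℚ.+-0-rawMonoid using (sum)

-- When xs lists every element of A exactly once, words xs k lists every
-- element of Vec A k exactly once.
words : {A : Set} → List A → (k : ℕ) → List (Vec A k)
words xs zero    = [ [] ]
words xs (suc k) = cartesianProductWith _∷_ xs (words xs k)

count : {A : Set} {P : A → Set} → Decidable P → List A → ℕ
count P? xs = length (filter P? xs)

-- A permutation σ ∈ Sₙ is represented by its one-line word σ(0) … σ(n-1).
unique? : {n k : ℕ} → Decidable (Unique {A = Fin n} {k})
unique? = allPairs? (λ i j → ¬? (i Fin.≟ j))

descents : {n k : ℕ} → Vec (Fin n) k → ℕ
descents []          = 0
descents (_ ∷ [])    = 0
descents (i ∷ j ∷ w) = (if does (j Fin.<? i) then 1 else 0) + descents (j ∷ w)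

A : ℕ → ℕ → ℕ
A n j = count (λ w → unique? w ×-dec (descents w ≟ j)) (words (allFin n) n)

-- A probability distribution on {0, …, n-1} is given by its weights.
Dist : ℕ → Set
Dist n = Fin n → ℚ

π : (n : ℕ) → Dist n
π n j = (+ A n (toℕ j) ℚ./ (n !)) {{n !≢0}}

module Carries (b : ℕ) .{{_ : NonZero b}} where

  digitSum : {n : ℕ} → Vec (Fin b) n → ℕ
  digitSum x = Vec.sum (Vec.map toℕ x)

  step : {n : ℕ} → ℕ → Vec (Fin b) n → ℕ
  step k x = (k + digitSum x) / b

  run : {n r : ℕ} → ℕ → Vec (Vec (Fin b) n) r → ℕ
  run k []       = k
  run k (x ∷ xs) = run (step k x) xs

  κ : {n r : ℕ} → Vec (Vec (Fin b) n) r → ℕ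
  κ = run 0

  -- The chain never leaves {0, …, n-1}, so P₀ below loses no mass by being
  -- indexed by Fin n although κ is ℕ-valued.
  digitSum-bound : {n : ℕ} (x : Vec (Fin b) n) → digitSum x + n ≤ n * b
  digitSum-bound []              = z≤n
  digitSum-bound {suc n} (d ∷ x) = begin
    toℕ d + digitSum x + suc n    ≡⟨ +-suc (toℕ d + digitSum x) n ⟩
    suc (toℕ d + digitSum x + n)  ≡⟨ cong suc (+-assoc (toℕ d) (digitSum x) n) ⟩
    suc (toℕ d) + (digitSum x + n) ≤⟨ +-mono-≤ (Fin.toℕ<n d) (digitSum-bound x) ⟩
    b + n * b                     ∎
    where open ≤-Reasoning

  step-< : {n k : ℕ} (x : Vec (Fin b) n) → k < n → step k x < n
  step-< {n} {k} x k<n = m<n*o⇒m/o<n (begin-strict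
    k + digitSum x  <⟨ +-monoˡ-< (digitSum x) k<n ⟩
    n + digitSum x  ≡⟨ +-comm n (digitSum x) ⟩
    digitSum x + n  ≤⟨ digitSum-bound x ⟩
    n * b           ∎)
    where open ≤-Reasoning

  run-< : {n r k : ℕ} (xs : Vec (Vec (Fin b) n) r) → k < n → run k xs < n
  run-< []       k<n = k<n
  run-< (x ∷ xs) k<n = run-< xs (step-< x k<n)

  -- The digits are i.i.d. uniform exactly when all b^(n r) digit arrays are
  -- equally likely.
  P₀ : (n r : ℕ) → Dist n
  P₀ n r j = (+ count (λ xs → κ xs ≟ toℕ j) (words (words (allFin b) n) r)
               ℚ./ (b ^ (n * r))) {{m^n≢0 b (n * r)}}

open Carries public using (P₀)

‖_-_‖TV : {n : ℕ} → Dist n → Dist n → ℚ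
‖ P - Q ‖TV = ½ ℚ.* sum (λ x → ℚ.∣ P x ℚ.- Q x ∣)

-- A real number is given by a set of rationals of which it is the infimum.
-- This determines exactly which rationals x satisfy x ≤ U, which is the only
-- comparison needed.
UpperReal : Set₁
UpperReal = ℚ → Set

infixl 7 _/√_
infixl 6 _⊕_
infix  4 _≤ᵣ_

-- For a ≥ 0 and q > 0, the real number a / √q: its upper bounds are the u ≥ 0
-- with a² ≤ u² q.
_/√_ : ℚ → ℚ → UpperReal
(a /√ q) u = 0ℚ ℚ.≤ u × a ℚ.* a ℚ.≤ u ℚ.* u ℚ.* q

_⊕_ : UpperReal → UpperReal → UpperReal
(U ⊕ V) w = ∃₂ λ u v → U u × V v × w ≡ u ℚ.+ v

_≤ᵣ_ : ℚ → UpperReal → Set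
x ≤ᵣ U = ∀ u → U u → x ℚ.≤ u

{-# OPTIONS --safe #-}

-- Put M = b ^ r. The r steps in base b amount to one step in base M, so κ is the
-- law of ⌊S / M⌋ for S a sum of n uniform digits below M. Starting this step from
-- the carry k instead of 0 replaces S by S + k.
--
-- Smoothing: if a + p = M, raising one digit by a is a bijection from the digits
-- below p to those not below a. Hence E[f(S + a) #{i : Xᵢ < p}] = E[f(S) #{i : Xᵢ ≥ a}],
-- and as both counts concentrate around n p / M, the laws of S and S + a differ by
-- O(1 / √n) when p ≥ a / 2. Two such shifts give a shift by M, and
--   E f(S + 1) - E f(S) = (E f(S′ + M) - E f(S′)) / M,   S′ with n - 1 digits,
-- so a shift by k < n costs O(n / (M √n)) = O(√n / M) = O(1 / √c).
--
-- Consequently one step in base N = M L, which is a step in base L followed by one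
-- in base M, is that close to a step in base M, for every L. Partial sums modulo N
-- identify ⌊S_N / N⌋ with the number of descents of a uniform word in [N]ⁿ. Such a
-- word is injective up to probability n² / N, and the descents of a uniform
-- injective word are those of a uniform permutation, as one sees on Lehmer codes.
-- With L = n² this last error is at most 1 / M.

module Submission where

open import Defs
open import Data.Integer.Base using (+_)
open import Data.Nat.Base as ℕ using (ℕ; NonZero; _^_; _≥_)
open import Data.Product.Base using (∃-syntax; _×_)
open import Data.Rational.Base using (ℚ; 0ℚ; 1ℚ; _/_; _<_; _>_)

open import Algebra.Definitions.RawMonoid Data.Rational.Base.+-0-rawMonoid using (sum)
open import Data.Bool.Base using (Bool; true; false; if_then_else_; not; _∧_)
open import Data.Fin.Base as Fin using (Fin; toℕ; punchIn)
import Data.Fin.Properties as Fin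
open import Data.Integer.Base as ℤ using (ℤ; -[1+_]; 0ℤ; 1ℤ; ∣_∣; _+_; _*_; _-_; -_; _≤_)
import Data.Integer.Properties as ℤ
open import Data.Integer.Tactic.RingSolver using (solve-∀)
open import Data.List.Base using (List; []; _∷_; _++_; map; length; upTo; applyUpTo; allFin; tabulate; cartesianProductWith)
import Data.List.Properties as List
open import Data.List.Relation.Unary.All as All using (All; []; _∷_)
import Data.List.Relation.Unary.All.Properties as All
open import Data.Nat.Base using (_!)
open import Data.Nat.Divisibility using (n∣m*n)
import Data.Nat.DivMod as ℕ
import Data.Nat.Properties as ℕ
import Data.Nat.Tactic.RingSolver as ℕSolver
open import Data.Product.Base using (_,_)
import Data.Rational.Base as ℚ
import Data.Rational.Properties as ℚ
import Data.Rational.Unnormalised.Base as ℚᵘ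
import Data.Rational.Unnormalised.Properties as ℚᵘ
open import Data.Vec.Base as Vec using (Vec; []; _∷_)
import Data.Vec.Relation.Unary.All as VecAll
open import Function.Base using (_∘_; id)
open import Function.Bundles using (mk⇔)
open import Relation.Binary.Definitions using (tri<; tri≈; tri>)
open import Relation.Binary.PropositionalEquality
open import Relation.Nullary using (yes; no; contradiction; does; ¬?; _×-dec_)
open import Relation.Nullary.Decidable using (dec-true; dec-false; does-⇔)
open import Relation.Unary using (Decidable)
open Carries using (digitSum; run; step; κ)

-- Finite sums over lists, words and initial segments of ℕ

private
  variable
    Ω Ω₁ Ω₂ : Set

∑ : List Ω → (Ω → ℤ) → ℤ
∑ []       f = 0ℤ
∑ (x ∷ xs) f = f x + ∑ xs f

infix 3 ∑
syntax ∑ xs (λ x → e) = ∑[ x ∈ xs ] e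

∑-cong-All : ∀ {xs : List Ω} {f g} → All (λ x → f x ≡ g x) xs → ∑ xs f ≡ ∑ xs g
∑-cong-All []       = refl
∑-cong-All (p ∷ ps) = cong₂ _+_ p (∑-cong-All ps)

∑-cong : ∀ (xs : List Ω) {f g} → (∀ x → f x ≡ g x) → ∑ xs f ≡ ∑ xs g
∑-cong xs f≗g = ∑-cong-All (All.universal f≗g xs)

∑-mono-All : ∀ {xs : List Ω} {f g} → All (λ x → f x ≤ g x) xs → ∑ xs f ≤ ∑ xs g
∑-mono-All []       = ℤ.≤-refl
∑-mono-All (p ∷ ps) = ℤ.+-mono-≤ p (∑-mono-All ps)

∑-mono : ∀ (xs : List Ω) {f g} → (∀ x → f x ≤ g x) → ∑ xs f ≤ ∑ xs g
∑-mono xs f≤g = ∑-mono-All (All.universal f≤g xs)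

∑-++ : ∀ (xs ys : List Ω) f → ∑ (xs ++ ys) f ≡ ∑ xs f + ∑ ys f
∑-++ []       ys f = sym (ℤ.+-identityˡ _)
∑-++ (x ∷ xs) ys f = trans (cong (_+_ (f x)) (∑-++ xs ys f)) (sym (ℤ.+-assoc (f x) _ _))

∑-map : ∀ (h : Ω → Ω₁) xs f → ∑ (map h xs) f ≡ ∑ xs (f ∘ h)
∑-map h []       f = refl
∑-map h (x ∷ xs) f = cong (_+_ (f (h x))) (∑-map h xs f)

∑-+ : ∀ (xs : List Ω) f g → ∑ xs (λ x → f x + g x) ≡ ∑ xs f + ∑ xs g
∑-+ []       f g = refl
∑-+ (x ∷ xs) f g = trans (cong (_+_ ((f x + g x))) (∑-+ xs f g)) (lemma (f x) (g x) _ _)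
  where
  lemma : ∀ a b c d → a + b + (c + d) ≡ a + c + (b + d)
  lemma = solve-∀

∑-*ˡ : ∀ c (xs : List Ω) f → ∑ xs (λ x → c * f x) ≡ c * ∑ xs f
∑-*ˡ c []       f = sym (ℤ.*-zeroʳ c)
∑-*ˡ c (x ∷ xs) f = trans (cong (_+_ ((c * f x))) (∑-*ˡ c xs f)) (sym (ℤ.*-distribˡ-+ c (f x) (∑ xs f)))

∑-*ʳ : ∀ c (xs : List Ω) f → ∑ xs (λ x → f x * c) ≡ ∑ xs f * c
∑-*ʳ c xs f = begin
  ∑[ x ∈ xs ] f x * c  ≡⟨ ∑-cong xs (λ x → ℤ.*-comm (f x) c) ⟩
  ∑[ x ∈ xs ] c * f x  ≡⟨ ∑-*ˡ c xs f ⟩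
  c * ∑ xs f           ≡⟨ ℤ.*-comm c _ ⟩
  ∑ xs f * c           ∎
  where open ≡-Reasoning

∑-neg : ∀ (xs : List Ω) f → ∑ xs (λ x → - f x) ≡ - ∑ xs f
∑-neg []       f = refl
∑-neg (x ∷ xs) f = trans (cong (_+_ ((- f x))) (∑-neg xs f)) (sym (ℤ.neg-distrib-+ (f x) _))

∑-- : ∀ (xs : List Ω) f g → ∑ xs (λ x → f x - g x) ≡ ∑ xs f - ∑ xs g
∑-- xs f g = trans (∑-+ xs f _) (cong (_+_ (∑ xs f)) (∑-neg xs g))

∑-const : ∀ (xs : List Ω) c → (∑[ x ∈ xs ] c) ≡ + length xs * c
∑-const []       c = refl
∑-const (x ∷ xs) c = trans (cong (_+_ c) (∑-const xs c)) (lemma (+ length xs) c)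
  where
  lemma : ∀ n c → c + n * c ≡ (1ℤ + n) * c
  lemma = solve-∀

∑-swap : ∀ (xs : List Ω) (ys : List Ω₁) (f : Ω → Ω₁ → ℤ) →
         (∑[ x ∈ xs ] ∑[ y ∈ ys ] f x y) ≡ (∑[ y ∈ ys ] ∑[ x ∈ xs ] f x y)
∑-swap []       ys f = sym (trans (∑-const ys 0ℤ) (ℤ.*-zeroʳ (+ length ys)))
∑-swap (x ∷ xs) ys f = trans (cong (_+_ (∑ ys (f x))) (∑-swap xs ys f)) (sym (∑-+ ys (f x) (λ y → ∑[ z ∈ xs ] f z y)))

∑-cartesianProductWith : ∀ (h : Ω → Ω₁ → Ω₂) xs ys f →
  ∑ (cartesianProductWith h xs ys) f ≡ (∑[ x ∈ xs ] ∑[ y ∈ ys ] f (h x y))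
∑-cartesianProductWith h []       ys f = refl
∑-cartesianProductWith h (x ∷ xs) ys f =
  trans (∑-++ (map (h x) ys) _ f) (cong₂ _+_ (∑-map (h x) ys f) (∑-cartesianProductWith h xs ys f))

∑-words-suc : ∀ (xs : List Ω) k f →
  ∑ (words xs (ℕ.suc k)) f ≡ (∑[ x ∈ xs ] ∑[ w ∈ words xs k ] f (x ∷ w))
∑-words-suc xs k f = ∑-cartesianProductWith _∷_ xs (words xs k) f

length-cartesianProductWith : ∀ (h : Ω → Ω₁ → Ω₂) xs ys →
  length (cartesianProductWith h xs ys) ≡ length xs ℕ.* length ys
length-cartesianProductWith h []       ys = refl
length-cartesianProductWith h (x ∷ xs) ys = trans (List.length-++ (map (h x) ys))
  (cong₂ ℕ._+_ (List.length-map (h x) ys) (length-cartesianProductWith h xs ys))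

length-words : ∀ (xs : List Ω) k → length (words xs k) ≡ length xs ^ k
length-words xs ℕ.zero    = refl
length-words xs (ℕ.suc k) =
  trans (length-cartesianProductWith _∷_ xs (words xs k)) (cong (length xs ℕ.*_) (length-words xs k))

length-words-upTo : ∀ n k → length (words (upTo n) k) ≡ n ^ k
length-words-upTo n k = trans (length-words (upTo n) k) (cong (_^ k) (List.length-upTo n))

∑-applyUpTo : ∀ (h : ℕ → Ω) n f → ∑ (applyUpTo h n) f ≡ ∑ (upTo n) (f ∘ h)
∑-applyUpTo h ℕ.zero    f = refl
∑-applyUpTo h (ℕ.suc n) f =
  cong (_+_ (f (h 0))) (trans (∑-applyUpTo (h ∘ ℕ.suc) n f) (sym (∑-applyUpTo ℕ.suc n (f ∘ h))))

∑-upTo-suc : ∀ n f → ∑ (upTo (ℕ.suc n)) f ≡ f 0 + ∑ (upTo n) (f ∘ ℕ.suc)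
∑-upTo-suc n f = cong (_+_ (f 0)) (∑-applyUpTo ℕ.suc n f)

∑-upTo-+ : ∀ m n f → ∑ (upTo (m ℕ.+ n)) f ≡ ∑ (upTo m) f + (∑[ i ∈ upTo n ] f (m ℕ.+ i))
∑-upTo-+ ℕ.zero    n f = sym (ℤ.+-identityˡ _)
∑-upTo-+ (ℕ.suc m) n f = begin
  ∑ (upTo (ℕ.suc (m ℕ.+ n))) f                            ≡⟨ ∑-upTo-suc (m ℕ.+ n) f ⟩
  f 0 + ∑ (upTo (m ℕ.+ n)) (f ∘ ℕ.suc)                    ≡⟨ cong (_+_ (f 0)) (∑-upTo-+ m n (f ∘ ℕ.suc)) ⟩
  f 0 + (∑ (upTo m) (f ∘ ℕ.suc) + rest)                   ≡⟨ ℤ.+-assoc (f 0) _ _ ⟨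
  f 0 + ∑ (upTo m) (f ∘ ℕ.suc) + rest                     ≡⟨ cong (_+ rest) (∑-upTo-suc m f) ⟨
  ∑ (upTo (ℕ.suc m)) f + rest                             ∎
  where
  open ≡-Reasoning
  rest = ∑[ i ∈ upTo n ] f (ℕ.suc m ℕ.+ i)

∑-upTo-last : ∀ n f → ∑ (upTo (ℕ.suc n)) f ≡ ∑ (upTo n) f + f n
∑-upTo-last n f = begin
  ∑ (upTo (ℕ.suc n)) f                ≡⟨ cong (λ k → ∑ (upTo k) f) (ℕ.+-comm 1 n) ⟩
  ∑ (upTo (n ℕ.+ 1)) f                ≡⟨ ∑-upTo-+ n 1 f ⟩
  ∑ (upTo n) f + (f (n ℕ.+ 0) + 0ℤ)   ≡⟨ cong (_+_ (∑ (upTo n) f)) (trans (ℤ.+-identityʳ _) (cong f (ℕ.+-identityʳ n))) ⟩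
  ∑ (upTo n) f + f n                  ∎
  where open ≡-Reasoning

All-upTo : ∀ {P : ℕ → Set} n → (∀ {i} → i ℕ.< n → P i) → All P (upTo n)
All-upTo n p = All.applyUpTo⁺₁ id n p

∑-telescope : ∀ n f → (∑[ i ∈ upTo n ] f (ℕ.suc i) - f i) ≡ f n - f 0
∑-telescope n f = begin
  (∑[ i ∈ upTo n ] f (ℕ.suc i) - f i)                ≡⟨ ∑-- (upTo n) (f ∘ ℕ.suc) f ⟩
  ∑ (upTo n) (f ∘ ℕ.suc) - ∑ (upTo n) f              ≡⟨ lemma (f 0) _ (∑ (upTo n) f) ⟩
  f 0 + ∑ (upTo n) (f ∘ ℕ.suc) - f 0 - ∑ (upTo n) f  ≡⟨ cong (λ s → s - f 0 - ∑ (upTo n) f) (trans (sym (∑-upTo-suc n f)) (∑-upTo-last n f)) ⟩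
  ∑ (upTo n) f + f n - f 0 - ∑ (upTo n) f            ≡⟨ lemma′ (f 0) (f n) (∑ (upTo n) f) ⟩
  f n - f 0                                          ∎
  where
  open ≡-Reasoning
  lemma : ∀ a b c → b - c ≡ a + b - a - c
  lemma = solve-∀
  lemma′ : ∀ a b c → c + b - a - c ≡ b - a
  lemma′ = solve-∀

-- Squares and the Cauchy-Schwarz inequality

0≤i*i : ∀ i → 0ℤ ≤ i * i
0≤i*i (+ n)    = subst (0ℤ ≤_) (ℤ.pos-* n n) (ℤ.+≤+ ℕ.z≤n)
0≤i*i -[1+ n ] = ℤ.+≤+ ℕ.z≤n

∑-nonneg : ∀ (xs : List Ω) {f} → (∀ x → 0ℤ ≤ f x) → 0ℤ ≤ ∑ xs f
∑-nonneg xs {f} f≥0 =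
  subst (_≤ ∑ xs f) (trans (∑-const xs 0ℤ) (ℤ.*-zeroʳ (+ length xs))) (∑-mono xs f≥0)

-- Deviations from the mean, scaled by the length ℓ to stay integral, have squares adding up to ℓ (ℓ
-- q - s²). This is nonnegative, and ℓ > 0 cancels.
∑-cauchy-schwarz : ∀ (xs : List Ω) f → ∑ xs f * ∑ xs f ≤ + length xs * (∑[ x ∈ xs ] f x * f x)
∑-cauchy-schwarz []             f = ℤ.≤-refl
∑-cauchy-schwarz xs@(_ ∷ _) f = ℤ.*-cancelˡ-≤-pos _ _ ℓ (ℤ.0≤i-j⇒j≤i (subst (0ℤ ≤_) expand (∑-nonneg xs (λ x → 0≤i*i (ℓ * f x - s)))))
  where
  open ≡-Reasoning
  ℓ = + length xs
  s = ∑ xs f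
  q = ∑[ x ∈ xs ] f x * f x
  square : ∀ ℓ s y → (ℓ * y - s) * (ℓ * y - s) ≡ ℓ * ℓ * (y * y) - (+ 2 * ℓ * s) * y + s * s
  square = solve-∀
  collect : ∀ ℓ s q → ℓ * ℓ * q - + 2 * ℓ * s * s + ℓ * (s * s) ≡ ℓ * (ℓ * q) - ℓ * (s * s)
  collect = solve-∀
  expand : (∑[ x ∈ xs ] (ℓ * f x - s) * (ℓ * f x - s)) ≡ ℓ * (ℓ * q) - ℓ * (s * s)
  expand = begin
    (∑[ x ∈ xs ] (ℓ * f x - s) * (ℓ * f x - s))
      ≡⟨ ∑-cong xs (λ x → square ℓ s (f x)) ⟩
    (∑[ x ∈ xs ] ℓ * ℓ * (f x * f x) - (+ 2 * ℓ * s) * f x + s * s)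
      ≡⟨ ∑-+ xs (λ x → ℓ * ℓ * (f x * f x) - (+ 2 * ℓ * s) * f x) (λ _ → s * s) ⟩
    (∑[ x ∈ xs ] ℓ * ℓ * (f x * f x) - (+ 2 * ℓ * s) * f x) + (∑[ x ∈ xs ] s * s)
      ≡⟨ cong₂ _+_ (∑-- xs (λ x → ℓ * ℓ * (f x * f x)) (λ x → (+ 2 * ℓ * s) * f x)) (∑-const xs (s * s)) ⟩
    (∑[ x ∈ xs ] ℓ * ℓ * (f x * f x)) - (∑[ x ∈ xs ] (+ 2 * ℓ * s) * f x) + ℓ * (s * s)
      ≡⟨ cong (_+ ℓ * (s * s)) (cong₂ _-_ (∑-*ˡ (ℓ * ℓ) xs (λ x → f x * f x)) (∑-*ˡ (+ 2 * ℓ * s) xs f)) ⟩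
    ℓ * ℓ * q - + 2 * ℓ * s * s + ℓ * (s * s)
      ≡⟨ collect ℓ s q ⟩
    ℓ * (ℓ * q) - ℓ * (s * s)
      ∎

-- Sums of independent digits

𝟙 : Bool → ℤ
𝟙 b = if b then 1ℤ else 0ℤ

-- M ^ n times the expectation of F (k + S), where S is a sum of n independent uniform digits below
-- M. Leaving out the normalisation keeps all estimates in ℤ.
∑-digits : (M n : ℕ) → (ℕ → ℤ) → ℕ → ℤ
∑-digits M n F k = ∑[ x ∈ words (upTo M) n ] F (k ℕ.+ Vec.sum x)

∑-digits-zero : ∀ M F k → ∑-digits M 0 F k ≡ F k
∑-digits-zero M F k = trans (ℤ.+-identityʳ _) (cong F (ℕ.+-identityʳ k))

∑-digits-suc : ∀ M n F k → ∑-digits M (ℕ.suc n) F k ≡ (∑[ i ∈ upTo M ] ∑-digits M n F (k ℕ.+ i))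
∑-digits-suc M n F k = trans
  (∑-words-suc (upTo M) n (λ x → F (k ℕ.+ Vec.sum x)))
  (∑-cong (upTo M) λ i → ∑-cong (words (upTo M) n) λ x → cong F (sym (ℕ.+-assoc k i (Vec.sum x))))

-- Raising k by one shifts the range of the first digit by one, so the sum over that digit
-- telescopes to its two ends.
∑-digits-difference : ∀ M n F k →
  ∑-digits M (ℕ.suc n) F (ℕ.suc k) - ∑-digits M (ℕ.suc n) F k ≡ ∑-digits M n F (k ℕ.+ M) - ∑-digits M n F k
∑-digits-difference M n F k = begin
  ∑-digits M (ℕ.suc n) F (ℕ.suc k) - ∑-digits M (ℕ.suc n) F k
    ≡⟨ cong₂ _-_ (trans (∑-digits-suc M n F (ℕ.suc k)) (∑-cong (upTo M) λ i → cong (∑-digits M n F) (sym (ℕ.+-suc k i))))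
                 (∑-digits-suc M n F k) ⟩
  ∑ (upTo M) (g ∘ ℕ.suc) - ∑ (upTo M) g
    ≡⟨ ∑-- (upTo M) (g ∘ ℕ.suc) g ⟨
  (∑[ i ∈ upTo M ] g (ℕ.suc i) - g i)
    ≡⟨ ∑-telescope M g ⟩
  g M - g 0
    ≡⟨ cong (λ j → g M - ∑-digits M n F j) (ℕ.+-identityʳ k) ⟩
  ∑-digits M n F (k ℕ.+ M) - ∑-digits M n F k
    ∎
  where
  open ≡-Reasoning
  g : ℕ → ℤ
  g i = ∑-digits M n F (k ℕ.+ i)

-- Additive statistics of digit words

additive : ∀ {n} → (ℕ → ℤ) → Vec ℕ n → ℤ
additive φ []      = 0ℤ
additive φ (i ∷ x) = φ i + additive φ x

additive-affine : ∀ {n} m c (φ : ℕ → ℤ) (x : Vec ℕ n) →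
  additive (λ i → m * φ i - c) x ≡ m * additive φ x - + n * c
additive-affine m c φ [] = lemma m c
  where
  lemma : ∀ m c → 0ℤ ≡ m * 0ℤ - 0ℤ * c
  lemma = solve-∀
additive-affine {ℕ.suc n} m c φ (i ∷ x) = trans (cong (_+_ (m * φ i - c)) (additive-affine m c φ x)) (lemma m c (φ i) (additive φ x) (+ n))
  where
  lemma : ∀ m c y z n → m * y - c + (m * z - n * c) ≡ m * (y + z) - (1ℤ + n) * c
  lemma = solve-∀

-- The hypothesis says that i ↦ a + i carries the weight φ to the weight φ′.
additive-shift : ∀ {M a} {φ φ′ : ℕ → ℤ} →
  (∀ (G : ℕ → ℤ) → (∑[ i ∈ upTo M ] φ i * G (a ℕ.+ i)) ≡ (∑[ i ∈ upTo M ] φ′ i * G i)) →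
  ∀ n (F : ℕ → ℤ) k → (∑[ x ∈ words (upTo M) n ] additive φ x * F (a ℕ.+ k ℕ.+ Vec.sum x)) ≡
            (∑[ x ∈ words (upTo M) n ] additive φ′ x * F (k ℕ.+ Vec.sum x))
additive-shift             φ⇒φ′ ℕ.zero    F k = refl
additive-shift {M} {a} {φ} {φ′} φ⇒φ′ (ℕ.suc n) F k = begin
  (∑[ x ∈ words (upTo M) (ℕ.suc n) ] additive φ x * F (a ℕ.+ k ℕ.+ Vec.sum x))
    ≡⟨ split φ (a ℕ.+ k) ⟩
  (∑[ i ∈ upTo M ] φ i * ∑-digits M n F (a ℕ.+ k ℕ.+ i)) +
  (∑[ i ∈ upTo M ] ∑[ x ∈ ws ] additive φ x * F (a ℕ.+ k ℕ.+ i ℕ.+ Vec.sum x))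
    ≡⟨ cong₂ _+_ (∑-cong (upTo M) λ i → cong (λ j → φ i * ∑-digits M n F j) (shuffle i))
                 (∑-cong (upTo M) λ i → ∑-cong ws λ x → cong (λ j → additive φ x * F (j ℕ.+ Vec.sum x)) (ℕ.+-assoc a k i)) ⟩
  (∑[ i ∈ upTo M ] φ i * ∑-digits M n F (k ℕ.+ (a ℕ.+ i))) +
  (∑[ i ∈ upTo M ] ∑[ x ∈ ws ] additive φ x * F (a ℕ.+ (k ℕ.+ i) ℕ.+ Vec.sum x))
    -- Where the first digit carries the weight, that digit absorbs the shift a by hypothesis;
    -- elsewhere the shift passes on to the remaining digits by induction.
    ≡⟨ cong₂ _+_ (φ⇒φ′ (λ j → ∑-digits M n F (k ℕ.+ j)))
                 (∑-cong (upTo M) λ i → additive-shift {M} {a} {φ} {φ′} φ⇒φ′ n F (k ℕ.+ i)) ⟩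
  (∑[ i ∈ upTo M ] φ′ i * ∑-digits M n F (k ℕ.+ i)) +
  (∑[ i ∈ upTo M ] ∑[ x ∈ ws ] additive φ′ x * F (k ℕ.+ i ℕ.+ Vec.sum x))
    ≡⟨ split φ′ k ⟨
  (∑[ x ∈ words (upTo M) (ℕ.suc n) ] additive φ′ x * F (k ℕ.+ Vec.sum x))
    ∎
  where
  open ≡-Reasoning
  ws = words (upTo M) n
  shuffle : ∀ i → a ℕ.+ k ℕ.+ i ≡ k ℕ.+ (a ℕ.+ i)
  shuffle i = trans (cong (ℕ._+ i) (ℕ.+-comm a k)) (ℕ.+-assoc k a i)
  split : ∀ (χ : ℕ → ℤ) j → (∑[ x ∈ words (upTo M) (ℕ.suc n) ] additive χ x * F (j ℕ.+ Vec.sum x)) ≡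
    (∑[ i ∈ upTo M ] χ i * ∑-digits M n F (j ℕ.+ i)) +
    (∑[ i ∈ upTo M ] ∑[ x ∈ ws ] additive χ x * F (j ℕ.+ i ℕ.+ Vec.sum x))
  split χ j = begin
    (∑[ x ∈ words (upTo M) (ℕ.suc n) ] additive χ x * F (j ℕ.+ Vec.sum x))
      ≡⟨ ∑-words-suc (upTo M) n (λ x → additive χ x * F (j ℕ.+ Vec.sum x)) ⟩
    (∑[ i ∈ upTo M ] ∑[ x ∈ ws ] (χ i + additive χ x) * F (j ℕ.+ (i ℕ.+ Vec.sum x)))
      ≡⟨ ∑-cong (upTo M) (λ i → ∑-cong ws λ x → trans
           (cong (λ l → (χ i + additive χ x) * F l) (sym (ℕ.+-assoc j i (Vec.sum x))))
           (ℤ.*-distribʳ-+ (F (j ℕ.+ i ℕ.+ Vec.sum x)) (χ i) (additive χ x))) ⟩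
    (∑[ i ∈ upTo M ] ∑[ x ∈ ws ] χ i * F (j ℕ.+ i ℕ.+ Vec.sum x) + additive χ x * F (j ℕ.+ i ℕ.+ Vec.sum x))
      ≡⟨ ∑-cong (upTo M) (λ i → trans
           (∑-+ ws (λ x → χ i * F (j ℕ.+ i ℕ.+ Vec.sum x)) (λ x → additive χ x * F (j ℕ.+ i ℕ.+ Vec.sum x)))
           (cong (_+ (∑[ x ∈ ws ] additive χ x * F (j ℕ.+ i ℕ.+ Vec.sum x))) (∑-*ˡ (χ i) ws (λ x → F (j ℕ.+ i ℕ.+ Vec.sum x))))) ⟩
    (∑[ i ∈ upTo M ] χ i * ∑-digits M n F (j ℕ.+ i) + (∑[ x ∈ ws ] additive χ x * F (j ℕ.+ i ℕ.+ Vec.sum x)))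
      ≡⟨ ∑-+ (upTo M) (λ i → χ i * ∑-digits M n F (j ℕ.+ i)) (λ i → ∑[ x ∈ ws ] additive χ x * F (j ℕ.+ i ℕ.+ Vec.sum x)) ⟩
    (∑[ i ∈ upTo M ] χ i * ∑-digits M n F (j ℕ.+ i)) +
    (∑[ i ∈ upTo M ] ∑[ x ∈ ws ] additive χ x * F (j ℕ.+ i ℕ.+ Vec.sum x))
      ∎

-- The cross terms, summed over the first digit, are a multiple of its mean 0. Hence the variances v
-- of the n digits add up.
additive-variance : ∀ M v (ψ : ℕ → ℤ) → ∑ (upTo M) ψ ≡ 0ℤ → (∑[ i ∈ upTo M ] ψ i * ψ i) ≡ v * + M →
  ∀ n → (∑[ x ∈ words (upTo M) n ] additive ψ x * additive ψ x) ≡ + n * v * + (M ^ n)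
additive-variance M v ψ mean var ℕ.zero    = sym (cong (_* 1ℤ) (ℤ.*-zeroˡ v))
additive-variance M v ψ mean var (ℕ.suc n) = begin
  (∑[ x ∈ words (upTo M) (ℕ.suc n) ] additive ψ x * additive ψ x)
    ≡⟨ ∑-words-suc (upTo M) n (λ x → additive ψ x * additive ψ x) ⟩
  (∑[ i ∈ upTo M ] ∑[ x ∈ ws ] (ψ i + additive ψ x) * (ψ i + additive ψ x))
    ≡⟨ ∑-cong (upTo M) inner ⟩
  (∑[ i ∈ upTo M ] ψ i * ψ i * + (M ^ n) + ψ i * (+ 2 * s) + q)
    ≡⟨ ∑-+ (upTo M) (λ i → ψ i * ψ i * + (M ^ n) + ψ i * (+ 2 * s)) (λ _ → q) ⟩
  (∑[ i ∈ upTo M ] ψ i * ψ i * + (M ^ n) + ψ i * (+ 2 * s)) + (∑[ i ∈ upTo M ] q)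
    ≡⟨ cong₂ _+_ (∑-+ (upTo M) (λ i → ψ i * ψ i * + (M ^ n)) (λ i → ψ i * (+ 2 * s)))
                 (trans (∑-const (upTo M) q) (cong (λ l → + l * q) (List.length-upTo M))) ⟩
  (∑[ i ∈ upTo M ] ψ i * ψ i * + (M ^ n)) + (∑[ i ∈ upTo M ] ψ i * (+ 2 * s)) + + M * q
    ≡⟨ cong₂ (λ a b → a + b + + M * q)
         (trans (∑-*ʳ (+ (M ^ n)) (upTo M) (λ i → ψ i * ψ i)) (cong (_* + (M ^ n)) var))
         (trans (∑-*ʳ (+ 2 * s) (upTo M) ψ) (cong (_* (+ 2 * s)) mean)) ⟩
  v * + M * + (M ^ n) + 0ℤ * (+ 2 * s) + + M * q
    ≡⟨ cong (λ y → v * + M * + (M ^ n) + 0ℤ * (+ 2 * s) + + M * y) (additive-variance M v ψ mean var n) ⟩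
  v * + M * + (M ^ n) + 0ℤ * (+ 2 * s) + + M * (+ n * v * + (M ^ n))
    ≡⟨ collect v (+ M) (+ (M ^ n)) s (+ n) ⟩
  (1ℤ + + n) * v * (+ M * + (M ^ n))
    ≡⟨ cong ((1ℤ + + n) * v *_) (ℤ.pos-* M (M ^ n)) ⟨
  + ℕ.suc n * v * + (M ^ ℕ.suc n)
    ∎
  where
  open ≡-Reasoning
  ws = words (upTo M) n
  s q : ℤ
  s = ∑ ws (additive ψ)
  q = ∑[ x ∈ ws ] additive ψ x * additive ψ x
  collect : ∀ v m p s n → v * m * p + 0ℤ * (+ 2 * s) + m * (n * v * p) ≡ (1ℤ + n) * v * (m * p)
  collect = solve-∀
  square : ∀ a b → (a + b) * (a + b) ≡ a * a + (+ 2 * a) * b + b * b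
  square = solve-∀
  arrange : ∀ a p s q → p * (a * a) + (+ 2 * a) * s + q ≡ a * a * p + a * (+ 2 * s) + q
  arrange = solve-∀
  inner : ∀ i → (∑[ x ∈ ws ] (ψ i + additive ψ x) * (ψ i + additive ψ x)) ≡ ψ i * ψ i * + (M ^ n) + ψ i * (+ 2 * s) + q
  inner i = begin
    (∑[ x ∈ ws ] (ψ i + additive ψ x) * (ψ i + additive ψ x))
      ≡⟨ ∑-cong ws (λ x → square (ψ i) (additive ψ x)) ⟩
    (∑[ x ∈ ws ] ψ i * ψ i + (+ 2 * ψ i) * additive ψ x + additive ψ x * additive ψ x)
      ≡⟨ ∑-+ ws (λ x → ψ i * ψ i + (+ 2 * ψ i) * additive ψ x) (λ x → additive ψ x * additive ψ x) ⟩
    (∑[ x ∈ ws ] ψ i * ψ i + (+ 2 * ψ i) * additive ψ x) + q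
      ≡⟨ cong (_+ q) (∑-+ ws (λ _ → ψ i * ψ i) (λ x → (+ 2 * ψ i) * additive ψ x)) ⟩
    (∑[ x ∈ ws ] ψ i * ψ i) + (∑[ x ∈ ws ] (+ 2 * ψ i) * additive ψ x) + q
      ≡⟨ cong₂ (λ a b → a + b + q)
           (trans (∑-const ws (ψ i * ψ i)) (cong (λ l → + l * (ψ i * ψ i)) (length-words-upTo M n)))
           (∑-*ˡ (+ 2 * ψ i) ws (additive ψ)) ⟩
    + (M ^ n) * (ψ i * ψ i) + (+ 2 * ψ i) * s + q
      ≡⟨ arrange (ψ i) (+ (M ^ n)) s q ⟩
    ψ i * ψ i * + (M ^ n) + ψ i * (+ 2 * s) + q
      ∎

-- Two-valued weights on digits

<⇒<ᵇ≡true : ∀ {m n} → m ℕ.< n → (m ℕ.<ᵇ n) ≡ true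
<⇒<ᵇ≡true {m} {n} = dec-true (m ℕ.<? n)

≥⇒<ᵇ≡false : ∀ {m n} → n ℕ.≤ m → (m ℕ.<ᵇ n) ≡ false
≥⇒<ᵇ≡false {m} {n} = dec-false (m ℕ.<? n) ∘ ℕ.≤⇒≯

-- The summand takes the outcome of the test as a separate argument, so that one lemma serves every
-- expression that branches on it.
∑-upTo-<ᵇ : ∀ m n (h : ℕ → Bool → ℤ) →
  (∑[ i ∈ upTo (m ℕ.+ n) ] h i (i ℕ.<ᵇ m)) ≡ (∑[ i ∈ upTo m ] h i true) + (∑[ i ∈ upTo n ] h (m ℕ.+ i) false)
∑-upTo-<ᵇ m n h = trans (∑-upTo-+ m n (λ i → h i (i ℕ.<ᵇ m))) (cong₂ _+_
  (∑-cong-All (All-upTo m λ {i} i<m → cong (h i) (<⇒<ᵇ≡true i<m)))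
  (∑-cong (upTo n) λ i → cong (h (m ℕ.+ i)) (≥⇒<ᵇ≡false (ℕ.m≤m+n m i))))

∑-upTo-<ᵇ-const : ∀ m n (h : Bool → ℤ) →
  (∑[ i ∈ upTo (m ℕ.+ n) ] h (i ℕ.<ᵇ m)) ≡ + m * h true + + n * h false
∑-upTo-<ᵇ-const m n h = trans (∑-upTo-<ᵇ m n (λ _ → h)) (cong₂ _+_ (const m (h true)) (const n (h false)))
  where
  const : ∀ l c → (∑[ i ∈ upTo l ] c) ≡ + l * c
  const l c = trans (∑-const (upTo l) c) (cong (λ j → + j * c) (List.length-upTo l))

module _ (a p : ℕ) where

  -- Among the a + p digits exactly p can be raised by a, namely those below p;
  -- their images are those not below a. Both weights have mean p / (a + p).
  below above centred-below centred-above : ℕ → ℤ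
  below i         = 𝟙 (i ℕ.<ᵇ p)
  above i         = 𝟙 (not (i ℕ.<ᵇ a))
  centred-below i = if i ℕ.<ᵇ p then + a else - (+ p)
  centred-above i = if i ℕ.<ᵇ a then - (+ p) else + a

  below⇒above : ∀ (G : ℕ → ℤ) → (∑[ i ∈ upTo (a ℕ.+ p) ] below i * G (a ℕ.+ i)) ≡ (∑[ i ∈ upTo (a ℕ.+ p) ] above i * G i)
  below⇒above G = begin
    (∑[ i ∈ upTo (a ℕ.+ p) ] below i * G (a ℕ.+ i))
      ≡⟨ cong (λ m → ∑[ i ∈ upTo m ] below i * G (a ℕ.+ i)) (ℕ.+-comm a p) ⟩
    (∑[ i ∈ upTo (p ℕ.+ a) ] below i * G (a ℕ.+ i))
      ≡⟨ ∑-upTo-<ᵇ p a (λ i b → 𝟙 b * G (a ℕ.+ i)) ⟩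
    (∑[ i ∈ upTo p ] 1ℤ * G (a ℕ.+ i)) + (∑[ i ∈ upTo a ] 0ℤ * G (a ℕ.+ (p ℕ.+ i)))
      ≡⟨ cong (_+_ (∑[ i ∈ upTo p ] 1ℤ * G (a ℕ.+ i))) (trans (zeros (λ i → G (a ℕ.+ (p ℕ.+ i)))) (sym (zeros G))) ⟩
    (∑[ i ∈ upTo p ] 1ℤ * G (a ℕ.+ i)) + (∑[ i ∈ upTo a ] 0ℤ * G i)
      ≡⟨ ℤ.+-comm (∑[ i ∈ upTo p ] 1ℤ * G (a ℕ.+ i)) (∑[ i ∈ upTo a ] 0ℤ * G i) ⟩
    (∑[ i ∈ upTo a ] 0ℤ * G i) + (∑[ i ∈ upTo p ] 1ℤ * G (a ℕ.+ i))
      ≡⟨ ∑-upTo-<ᵇ a p (λ i b → 𝟙 (not b) * G i) ⟨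
    (∑[ i ∈ upTo (a ℕ.+ p) ] above i * G i)
      ∎
    where
    open ≡-Reasoning
    zeros : ∀ (H : ℕ → ℤ) → (∑[ i ∈ upTo a ] 0ℤ * H i) ≡ 0ℤ
    zeros H = trans (∑-*ˡ 0ℤ (upTo a) H) (ℤ.*-zeroˡ (∑ (upTo a) H))

  -- The deviation from the mean p / (a + p) is multiplied by a + p to make it an integer.
  centre-below : ∀ i → + (a ℕ.+ p) * below i - + p ≡ centred-below i
  centre-below i with i ℕ.<ᵇ p
  ... | true  = lemma (+ a) (+ p)
    where
    lemma : ∀ a p → (a + p) * 1ℤ - p ≡ a
    lemma = solve-∀
  ... | false = lemma (+ (a ℕ.+ p)) (+ p)
    where
    lemma : ∀ m p → m * 0ℤ - p ≡ - p
    lemma = solve-∀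

  centre-above : ∀ i → + (a ℕ.+ p) * above i - + p ≡ centred-above i
  centre-above i with i ℕ.<ᵇ a
  ... | false = lemma (+ a) (+ p)
    where
    lemma : ∀ a p → (a + p) * 1ℤ - p ≡ a
    lemma = solve-∀
  ... | true  = lemma (+ (a ℕ.+ p)) (+ p)
    where
    lemma : ∀ m p → m * 0ℤ - p ≡ - p
    lemma = solve-∀

  private
    ∑ψ : ∀ a p → p * a + a * (- p) ≡ 0ℤ
    ∑ψ = solve-∀
    ∑ψ² : ∀ a p → p * (a * a) + a * ((- p) * (- p)) ≡ p * a * (a + p)
    ∑ψ² = solve-∀

  -- The value is a on p digits and - p on a digits. These values sum to 0 and their squares to p a
  -- (a + p), which is a variance of p a per digit.
  below-variance : ∀ n → (∑[ x ∈ words (upTo (a ℕ.+ p)) n ] additive centred-below x * additive centred-below x) ≡ + n * (+ p * + a) * + ((a ℕ.+ p) ^ n)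
  below-variance = additive-variance (a ℕ.+ p) (+ p * + a) centred-below
    (trans (cong (λ m → ∑ (upTo m) centred-below) (ℕ.+-comm a p))
      (trans (∑-upTo-<ᵇ-const p a (λ b → if b then + a else - (+ p))) (∑ψ (+ a) (+ p))))
    (trans (cong (λ m → ∑ (upTo m) (λ i → centred-below i * centred-below i)) (ℕ.+-comm a p))
      (trans (∑-upTo-<ᵇ-const p a (λ b → (if b then + a else - (+ p)) * (if b then + a else - (+ p)))) (∑ψ² (+ a) (+ p))))

  above-variance : ∀ n → (∑[ x ∈ words (upTo (a ℕ.+ p)) n ] additive centred-above x * additive centred-above x) ≡ + n * (+ p * + a) * + ((a ℕ.+ p) ^ n)
  above-variance = additive-variance (a ℕ.+ p) (+ p * + a) centred-above
    (trans (∑-upTo-<ᵇ-const a p (λ b → if b then - (+ p) else + a))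
      (trans (ℤ.+-comm (+ a * (- (+ p))) (+ p * + a)) (∑ψ (+ a) (+ p))))
    (trans (∑-upTo-<ᵇ-const a p (λ b → (if b then - (+ p) else + a) * (if b then - (+ p) else + a)))
      (trans (ℤ.+-comm (+ a * ((- (+ p)) * (- (+ p)))) (+ p * (+ a * + a))) (∑ψ² (+ a) (+ p))))

additive-cong : ∀ {n} {φ χ : ℕ → ℤ} → (∀ i → φ i ≡ χ i) → (x : Vec ℕ n) → additive φ x ≡ additive χ x
additive-cong φ≗χ []      = refl
additive-cong φ≗χ (i ∷ x) = cong₂ _+_ (φ≗χ i) (additive-cong φ≗χ x)

-- This trades a weighted sum for its mean part, a multiple of the plain sum `∑ xs G`; the error is
-- the centred sum, which the variance controls.
∑-additive-centred : ∀ {n} m c (φ ψ : ℕ → ℤ) → (∀ i → m * φ i - c ≡ ψ i) → (xs : List (Vec ℕ n)) (G : Vec ℕ n → ℤ) →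
  (∑[ x ∈ xs ] additive ψ x * G x) ≡ m * (∑[ x ∈ xs ] additive φ x * G x) - + n * c * ∑ xs G
∑-additive-centred {n} m c φ ψ centre xs G = begin
  (∑[ x ∈ xs ] additive ψ x * G x)
    ≡⟨ ∑-cong xs (λ x → trans
         (cong (_* G x) (trans (sym (additive-cong centre x)) (additive-affine m c φ x)))
         (distrib m (additive φ x) (+ n * c) (G x))) ⟩
  (∑[ x ∈ xs ] m * (additive φ x * G x) - + n * c * G x)
    ≡⟨ ∑-- xs (λ x → m * (additive φ x * G x)) (λ x → + n * c * G x) ⟩
  (∑[ x ∈ xs ] m * (additive φ x * G x)) - (∑[ x ∈ xs ] + n * c * G x)
    ≡⟨ cong₂ _-_ (∑-*ˡ m xs (λ x → additive φ x * G x)) (∑-*ˡ (+ n * c) xs G) ⟩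
  m * (∑[ x ∈ xs ] additive φ x * G x) - + n * c * ∑ xs G
    ∎
  where
  open ≡-Reasoning
  distrib : ∀ m s d g → (m * s - d) * g ≡ m * (s * g) - d * g
  distrib = solve-∀

-- Smoothing: the law of a digit sum changes little under shifts

[i-j]²≤2[i²+j²] : ∀ i j → (i - j) * (i - j) ≤ + 2 * (i * i + j * j)
[i-j]²≤2[i²+j²] i j = ℤ.0≤i-j⇒j≤i (subst (0ℤ ≤_) (lemma i j) (0≤i*i (i + j)))
  where
  lemma : ∀ i j → (i + j) * (i + j) ≡ + 2 * (i * i + j * j) - (i - j) * (i - j)
  lemma = solve-∀

module _ {M n : ℕ} {F : ℕ → ℤ} (F²≡1 : ∀ k → F k * F k ≡ 1ℤ) where

  -- By Cauchy-Schwarz, as F² = 1 removes the test function from the squares.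
  ∑-additive-± : ∀ (ψ : ℕ → ℤ) v → (∑[ x ∈ words (upTo M) n ] additive ψ x * additive ψ x) ≡ v →
    ∀ k → let s = ∑[ x ∈ words (upTo M) n ] additive ψ x * F (k ℕ.+ Vec.sum x) in s * s ≤ + (M ^ n) * v
  ∑-additive-± ψ v var k = subst₂ (λ l q → s * s ≤ + l * q) (length-words-upTo M n)
    (trans (∑-cong ws λ x → unit (additive ψ x) (F (k ℕ.+ Vec.sum x)) (F²≡1 (k ℕ.+ Vec.sum x))) var)
    (∑-cauchy-schwarz ws (λ x → additive ψ x * F (k ℕ.+ Vec.sum x)))
    where
    ws = words (upTo M) n
    s = ∑[ x ∈ ws ] additive ψ x * F (k ℕ.+ Vec.sum x)
    regroup : ∀ a f → a * f * (a * f) ≡ a * a * (f * f)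
    regroup = solve-∀
    unit : ∀ a f → f * f ≡ 1ℤ → a * f * (a * f) ≡ a * a
    unit a f ff = trans (regroup a f) (trans (cong (a * a *_) ff) (ℤ.*-identityʳ (a * a)))

-- Squaring the equation gives n² p² Δ² ≤ 4 n p a Q². After cancelling n p, the hypothesis a ≤ 2 p
-- turns 4 a into 8 p, and the last p cancels.
cancel-square : ∀ n p a Q Δ u v → .{{ℤ.Positive n}} → .{{ℤ.Positive p}} → 0ℤ ≤ Q → a ≤ + 2 * p →
  n * p * Δ ≡ u - v → u * u ≤ Q * (n * (p * a) * Q) → v * v ≤ Q * (n * (p * a) * Q) →
  n * (Δ * Δ) ≤ + 8 * (Q * Q)
cancel-square n p a Q Δ u v Q≥0 a≤2p eq u² v² = ℤ.*-cancelˡ-≤-pos _ _ p (begin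
  p * (n * (Δ * Δ))           ≡⟨ swap₁ p n (Δ * Δ) ⟩
  n * (p * (Δ * Δ))           ≤⟨ bound ⟩
  + 4 * a * (Q * Q)           ≡⟨ swap₂ a (Q * Q) ⟩
  + 4 * (Q * Q) * a           ≤⟨ ℤ.*-monoˡ-≤-nonNeg (+ 4 * (Q * Q)) {{ℤ.nonNegative (4Q²≥0)}} a≤2p ⟩
  + 4 * (Q * Q) * (+ 2 * p)   ≡⟨ swap₃ p (Q * Q) ⟩
  p * (+ 8 * (Q * Q))         ∎)
  where
  open ℤ.≤-Reasoning
  swap₁ : ∀ p n d → p * (n * d) ≡ n * (p * d)
  swap₁ = solve-∀
  swap₂ : ∀ a q → + 4 * a * q ≡ + 4 * q * a
  swap₂ = solve-∀
  swap₃ : ∀ p q → + 4 * q * (+ 2 * p) ≡ p * (+ 8 * q)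
  swap₃ = solve-∀
  4Q²≥0 : 0ℤ ≤ + 4 * (Q * Q)
  4Q²≥0 = subst (_≤ + 4 * (Q * Q)) (ℤ.*-zeroʳ (+ 4)) (ℤ.*-monoˡ-≤-nonNeg (+ 4) (0≤i*i Q))
  expand : ∀ n p d → n * (p * (n * (p * (d * d)))) ≡ n * p * d * (n * p * d)
  expand = solve-∀
  collect : ∀ n p a q → + 2 * (q * (n * (p * a) * q) + q * (n * (p * a) * q)) ≡ n * (p * (+ 4 * a * (q * q)))
  collect = solve-∀
  bound : n * (p * (Δ * Δ)) ≤ + 4 * a * (Q * Q)
  bound = ℤ.*-cancelˡ-≤-pos _ _ p (ℤ.*-cancelˡ-≤-pos _ _ n (begin
    n * (p * (n * (p * (Δ * Δ))))  ≡⟨ expand n p Δ ⟩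
    n * p * Δ * (n * p * Δ)        ≡⟨ cong (λ y → y * y) eq ⟩
    (u - v) * (u - v)              ≤⟨ [i-j]²≤2[i²+j²] u v ⟩
    + 2 * (u * u + v * v)          ≤⟨ ℤ.*-monoˡ-≤-nonNeg (+ 2) (ℤ.+-mono-≤ u² v²) ⟩
    + 2 * (Q * (n * (p * a) * Q) + Q * (n * (p * a) * Q)) ≡⟨ collect n p a Q ⟩
    n * (p * (+ 4 * a * (Q * Q)))  ∎))

module _ {n : ℕ} .{{_ : NonZero n}} {F : ℕ → ℤ} (F²≡1 : ∀ k → F k * F k ≡ 1ℤ) where

  -- By `additive-shift`, the count of digits below p with the shift a and the count of digits not
  -- below a without it give the same weighted sum w. Replacing both counts by their common mean n p
  -- / M leaves the two plain sums, up to the centred sums u and v.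
  digits-shift : ∀ a p .{{_ : NonZero p}} → a ℕ.≤ 2 ℕ.* p → ∀ k →
    let Δ = ∑-digits (a ℕ.+ p) n F (a ℕ.+ k) - ∑-digits (a ℕ.+ p) n F k in
    + n * (Δ * Δ) ≤ + 8 * (+ ((a ℕ.+ p) ^ n) * + ((a ℕ.+ p) ^ n))
  digits-shift a p a≤2p k =
    cancel-square (+ n) (+ p) (+ a) (+ (M ^ n)) (D (a ℕ.+ k) - D k) u v
      {{ℤ.positive (ℤ.+<+ (ℕ.>-nonZero⁻¹ n))}} {{ℤ.positive (ℤ.+<+ (ℕ.>-nonZero⁻¹ p))}}
      (ℤ.+≤+ ℕ.z≤n) (subst (+ a ≤_) (ℤ.pos-* 2 p) (ℤ.+≤+ a≤2p)) difference
      (∑-additive-± {M} {n} {F} F²≡1 (centred-above a p) _ (above-variance a p n) k)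
      (∑-additive-± {M} {n} {F} F²≡1 (centred-below a p) _ (below-variance a p n) (a ℕ.+ k))
    where
    open ≡-Reasoning
    M = a ℕ.+ p
    D = ∑-digits M n F
    ws = words (upTo M) n
    u v w : ℤ
    u = ∑[ x ∈ ws ] additive (centred-above a p) x * F (k ℕ.+ Vec.sum x)
    v = ∑[ x ∈ ws ] additive (centred-below a p) x * F (a ℕ.+ k ℕ.+ Vec.sum x)
    w = ∑[ x ∈ ws ] additive (above a p) x * F (k ℕ.+ Vec.sum x)
    telescope : ∀ m w c d e → c * (d - e) ≡ m * w - c * e - (m * w - c * d)
    telescope = solve-∀
    difference : + n * + p * (D (a ℕ.+ k) - D k) ≡ u - v
    difference = begin
      + n * + p * (D (a ℕ.+ k) - D k)
        ≡⟨ telescope (+ M) w (+ n * + p) (D (a ℕ.+ k)) (D k) ⟩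
      + M * w - + n * + p * D k - (+ M * w - + n * + p * D (a ℕ.+ k))
        ≡⟨ cong (λ y → + M * w - + n * + p * D k - (+ M * y - + n * + p * D (a ℕ.+ k)))
             (additive-shift {M} {a} {below a p} {above a p} (below⇒above a p) n F k) ⟨
      + M * w - + n * + p * D k - (+ M * (∑[ x ∈ ws ] additive (below a p) x * F (a ℕ.+ k ℕ.+ Vec.sum x)) - + n * + p * D (a ℕ.+ k))
        ≡⟨ cong₂ _-_ (∑-additive-centred (+ M) (+ p) (above a p) (centred-above a p) (centre-above a p) ws (λ x → F (k ℕ.+ Vec.sum x)))
                     (∑-additive-centred (+ M) (+ p) (below a p) (centred-below a p) (centre-below a p) ws (λ x → F (a ℕ.+ k ℕ.+ Vec.sum x))) ⟨
      u - v
        ∎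

module _ {n : ℕ} .{{_ : NonZero n}} {F : ℕ → ℤ} (F²≡1 : ∀ k → F k * F k ≡ 1ℤ) where

  -- A single shift by M would leave no digit that can be raised. So a shift by ⌈M/2⌉ is followed by
  -- one by ⌊M/2⌋, and 32 = 2 (8 + 8).
  digits-shift-base : ∀ M → 2 ℕ.≤ M → ∀ k →
    let Δ = ∑-digits M n F (k ℕ.+ M) - ∑-digits M n F k in
    + n * (Δ * Δ) ≤ + 32 * (+ (M ^ n) * + (M ^ n))
  digits-shift-base M 2≤M k = begin
    + n * ((D (k ℕ.+ M) - D k) * (D (k ℕ.+ M) - D k))
      ≡⟨ cong (λ y → + n * (y * y)) split ⟩
    + n * ((x - y) * (x - y))
      ≤⟨ ℤ.*-monoˡ-≤-nonNeg (+ n) ([i-j]²≤2[i²+j²] x y) ⟩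
    + n * (+ 2 * (x * x + y * y))
      ≡⟨ distrib (+ n) x y ⟩
    + 2 * (+ n * (x * x) + + n * ((- y) * (- y)))
      ≤⟨ ℤ.*-monoˡ-≤-nonNeg (+ 2) (ℤ.+-mono-≤ shift-a shift-p) ⟩
    + 2 * (+ 8 * (Q * Q) + + 8 * (Q * Q))
      ≡⟨ collect Q ⟩
    + 32 * (Q * Q)
      ∎
    where
    open ℤ.≤-Reasoning
    D = ∑-digits M n F
    a = ℕ.⌊ M /2⌋
    p = ℕ.⌈ M /2⌉
    Q x y : ℤ
    Q = + (M ^ n)
    x = D (a ℕ.+ (p ℕ.+ k)) - D (p ℕ.+ k)
    y = D k - D (p ℕ.+ k)
    a+p≡M : a ℕ.+ p ≡ M
    a+p≡M = ℕ.⌊n/2⌋+⌈n/2⌉≡n M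
    p+a≡M : p ℕ.+ a ≡ M
    p+a≡M = trans (ℕ.+-comm p a) a+p≡M
    1≤a : 1 ℕ.≤ a
    1≤a = ℕ.⌊n/2⌋-mono 2≤M
    a≤p : a ℕ.≤ p
    a≤p = ℕ.⌊n/2⌋≤⌈n/2⌉ M
    -- Indeed p ≤ 1 + a ≤ 2 a, where 1 ≤ a comes from 2 ≤ M.
    p≤2a : p ℕ.≤ 2 ℕ.* a
    p≤2a = ℕ.≤-trans (⌈/2⌉≤1+⌊/2⌋ M) (ℕ.+-mono-≤ 1≤a (ℕ.m≤m+n a 0))
      where
      ⌈/2⌉≤1+⌊/2⌋ : ∀ m → ℕ.⌈ m /2⌉ ℕ.≤ ℕ.suc ℕ.⌊ m /2⌋
      ⌈/2⌉≤1+⌊/2⌋ 0                     = ℕ.z≤n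
      ⌈/2⌉≤1+⌊/2⌋ 1                     = ℕ.s≤s ℕ.z≤n
      ⌈/2⌉≤1+⌊/2⌋ (ℕ.suc (ℕ.suc m)) = ℕ.s≤s (⌈/2⌉≤1+⌊/2⌋ m)
    a≤2p : a ℕ.≤ 2 ℕ.* p
    a≤2p = ℕ.≤-trans a≤p (ℕ.m≤m+n p _)
    shift-a : + n * (x * x) ≤ + 8 * (Q * Q)
    shift-a = subst (λ m → let Δ = ∑-digits m n F (a ℕ.+ (p ℕ.+ k)) - ∑-digits m n F (p ℕ.+ k) in
                           + n * (Δ * Δ) ≤ + 8 * (+ (m ^ n) * + (m ^ n)))
      a+p≡M (digits-shift {n} {F} F²≡1 a p {{ℕ.>-nonZero (ℕ.≤-trans 1≤a a≤p)}} a≤2p (p ℕ.+ k))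
    shift-p : + n * ((- y) * (- y)) ≤ + 8 * (Q * Q)
    shift-p = subst (λ z → + n * (z * z) ≤ + 8 * (Q * Q)) (flip (D (p ℕ.+ k)) (D k))
      (subst (λ m → let Δ = ∑-digits m n F (p ℕ.+ k) - ∑-digits m n F k in
                    + n * (Δ * Δ) ≤ + 8 * (+ (m ^ n) * + (m ^ n)))
        p+a≡M (digits-shift {n} {F} F²≡1 p a {{ℕ.>-nonZero 1≤a}} p≤2a k))
      where
      flip : ∀ a b → a - b ≡ - (b - a)
      flip = solve-∀
    split : D (k ℕ.+ M) - D k ≡ x - y
    split = trans (cong (λ j → D j - D k) (trans (ℕ.+-comm k M) (trans (cong (ℕ._+ k) (sym a+p≡M)) (ℕ.+-assoc a p k))))
      (insert (D (a ℕ.+ (p ℕ.+ k))) (D (p ℕ.+ k)) (D k))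
      where
      insert : ∀ a b c → a - c ≡ a - b - (c - b)
      insert = solve-∀
    distrib : ∀ n x y → n * (+ 2 * (x * x + y * y)) ≡ + 2 * (n * (x * x) + n * ((- y) * (- y)))
    distrib = solve-∀
    collect : ∀ q → + 2 * (+ 8 * (q * q) + + 8 * (q * q)) ≡ + 32 * (q * q)
    collect = solve-∀

  -- The shift by m consists of m unit shifts, each of which is a shift by M with one digit fewer.
  -- Divided by M ^ (n + 1), the difference is at most √(32 n) / M.
  digits-near : ∀ M → 2 ℕ.≤ M → ∀ m → m ℕ.≤ n →
    let Δ = ∑-digits M (ℕ.suc n) F m - ∑-digits M (ℕ.suc n) F 0 in
    Δ * Δ ≤ + n * (+ 32 * (+ (M ^ n) * + (M ^ n)))
  digits-near M 2≤M m m≤n = ℤ.*-cancelˡ-≤-pos _ _ (+ n) {{ℤ.positive (ℤ.+<+ (ℕ.>-nonZero⁻¹ n))}} (begin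
    + n * ((D m - D 0) * (D m - D 0))
      ≡⟨ cong (λ y → + n * (y * y)) (∑-telescope m D) ⟨
    + n * (∑ (upTo m) δ * ∑ (upTo m) δ)
      ≤⟨ ℤ.*-monoˡ-≤-nonNeg (+ n) (∑-cauchy-schwarz (upTo m) δ) ⟩
    + n * (+ length (upTo m) * (∑[ i ∈ upTo m ] δ i * δ i))
      ≡⟨ swap (+ n) (+ length (upTo m)) (∑[ i ∈ upTo m ] δ i * δ i) ⟩
    + length (upTo m) * (+ n * (∑[ i ∈ upTo m ] δ i * δ i))
      ≡⟨ cong (+ length (upTo m) *_) (∑-*ˡ (+ n) (upTo m) (λ i → δ i * δ i)) ⟨
    + length (upTo m) * (∑[ i ∈ upTo m ] + n * (δ i * δ i))
      ≤⟨ ℤ.*-monoˡ-≤-nonNeg (+ length (upTo m)) (∑-mono (upTo m) δ-bound) ⟩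
    + length (upTo m) * (∑[ i ∈ upTo m ] C)
      ≡⟨ cong (+ length (upTo m) *_) (∑-const (upTo m) C) ⟩
    + length (upTo m) * (+ length (upTo m) * C)
      ≡⟨ cong (λ l → + l * (+ l * C)) (List.length-upTo m) ⟩
    + m * (+ m * C)
      ≤⟨ ℤ.*-monoˡ-≤-nonNeg (+ m) (ℤ.*-monoʳ-≤-nonNeg C {{ℤ.nonNegative C≥0}} (ℤ.+≤+ m≤n)) ⟩
    + m * (+ n * C)
      ≤⟨ ℤ.*-monoʳ-≤-nonNeg (+ n * C) {{ℤ.nonNegative nC≥0}} (ℤ.+≤+ m≤n) ⟩
    + n * (+ n * C)
      ∎)
    where
    open ℤ.≤-Reasoning
    D = ∑-digits M (ℕ.suc n) F
    δ : ℕ → ℤ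
    δ i = D (ℕ.suc i) - D i
    C : ℤ
    C = + 32 * (+ (M ^ n) * + (M ^ n))
    δ-bound : ∀ i → + n * (δ i * δ i) ≤ C
    δ-bound i = subst (λ z → + n * (z * z) ≤ C) (sym (∑-digits-difference M n F i)) (digits-shift-base M 2≤M i)
    0≤* : ∀ k {z} → 0ℤ ≤ z → 0ℤ ≤ + k * z
    0≤* k {z} z≥0 = subst (_≤ + k * z) (ℤ.*-zeroʳ (+ k)) (ℤ.*-monoˡ-≤-nonNeg (+ k) z≥0)
    C≥0 : 0ℤ ≤ C
    C≥0 = 0≤* 32 (0≤i*i (+ (M ^ n)))
    nC≥0 : 0ℤ ≤ + n * C
    nC≥0 = 0≤* n C≥0
    swap : ∀ a b c → a * (b * c) ≡ b * (a * c)
    swap = solve-∀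

-- Carries in a product of two bases

∑-upTo-* : ∀ M b f → ∑ (upTo (M ℕ.* b)) f ≡ (∑[ j ∈ upTo M ] ∑[ i ∈ upTo b ] f (j ℕ.* b ℕ.+ i))
∑-upTo-* ℕ.zero    b f = refl
∑-upTo-* (ℕ.suc M) b f = begin
  ∑ (upTo (b ℕ.+ M ℕ.* b)) f
    ≡⟨ ∑-upTo-+ b (M ℕ.* b) f ⟩
  ∑ (upTo b) f + (∑[ i ∈ upTo (M ℕ.* b) ] f (b ℕ.+ i))
    ≡⟨ cong (_+_ (∑ (upTo b) f)) (trans (∑-upTo-* M b (λ i → f (b ℕ.+ i)))
         (∑-cong (upTo M) λ j → ∑-cong (upTo b) λ i → cong f (sym (ℕ.+-assoc b (j ℕ.* b) i)))) ⟩
  ∑ (upTo b) f + (∑[ j ∈ upTo M ] ∑[ i ∈ upTo b ] f (ℕ.suc j ℕ.* b ℕ.+ i))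
    ≡⟨ ∑-upTo-suc M (λ j → ∑[ i ∈ upTo b ] f (j ℕ.* b ℕ.+ i)) ⟨
  (∑[ j ∈ upTo (ℕ.suc M) ] ∑[ i ∈ upTo b ] f (j ℕ.* b ℕ.+ i))
    ∎
  where open ≡-Reasoning

-- Every digit below M b is j b + i for unique i below b and j below M; the low parts i add up,
-- together with k, to s and the high parts j to t.
∑-digits-* : ∀ M b n F k →
  ∑-digits (M ℕ.* b) n F k ≡ ∑-digits b n (λ s → ∑-digits M n (λ t → F (s ℕ.+ t ℕ.* b)) 0) k
∑-digits-* M b ℕ.zero    F k = begin
  ∑-digits (M ℕ.* b) 0 F k
    ≡⟨ ∑-digits-zero (M ℕ.* b) F k ⟩
  F k
    ≡⟨ cong F (ℕ.+-identityʳ k) ⟨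
  F (k ℕ.+ 0)
    ≡⟨ ∑-digits-zero M (λ t → F (k ℕ.+ t ℕ.* b)) 0 ⟨
  ∑-digits M 0 (λ t → F (k ℕ.+ t ℕ.* b)) 0
    ≡⟨ ∑-digits-zero b (λ s → ∑-digits M 0 (λ t → F (s ℕ.+ t ℕ.* b)) 0) k ⟨
  ∑-digits b 0 (λ s → ∑-digits M 0 (λ t → F (s ℕ.+ t ℕ.* b)) 0) k
    ∎
  where open ≡-Reasoning
∑-digits-* M b (ℕ.suc n) F k = begin
  ∑-digits (M ℕ.* b) (ℕ.suc n) F k
    ≡⟨ ∑-digits-suc (M ℕ.* b) n F k ⟩
  (∑[ l ∈ upTo (M ℕ.* b) ] ∑-digits (M ℕ.* b) n F (k ℕ.+ l))
    ≡⟨ ∑-cong (upTo (M ℕ.* b)) (λ l → ∑-digits-* M b n F (k ℕ.+ l)) ⟩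
  (∑[ l ∈ upTo (M ℕ.* b) ] ∑-digits b n (λ s → G s 0) (k ℕ.+ l))
    ≡⟨ ∑-upTo-* M b (λ l → ∑-digits b n (λ s → G s 0) (k ℕ.+ l)) ⟩
  (∑[ j ∈ upTo M ] ∑[ i ∈ upTo b ] ∑-digits b n (λ s → G s 0) (k ℕ.+ (j ℕ.* b ℕ.+ i)))
    ≡⟨ ∑-cong (upTo M) (λ j → ∑-cong (upTo b) λ i → carry j i) ⟩
  (∑[ j ∈ upTo M ] ∑[ i ∈ upTo b ] ∑-digits b n (λ s → G s j) (k ℕ.+ i))
    ≡⟨ ∑-swap (upTo M) (upTo b) (λ j i → ∑-digits b n (λ s → G s j) (k ℕ.+ i)) ⟩
  (∑[ i ∈ upTo b ] ∑[ j ∈ upTo M ] ∑-digits b n (λ s → G s j) (k ℕ.+ i))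
    ≡⟨ ∑-cong (upTo b) (λ i → ∑-swap (upTo M) (words (upTo b) n) (λ j x → G (k ℕ.+ i ℕ.+ Vec.sum x) j)) ⟩
  (∑[ i ∈ upTo b ] ∑-digits b n (λ s → ∑[ j ∈ upTo M ] G s j) (k ℕ.+ i))
    ≡⟨ ∑-cong (upTo b) (λ i → ∑-cong (words (upTo b) n) λ x →
         ∑-digits-suc M n (λ t → F (k ℕ.+ i ℕ.+ Vec.sum x ℕ.+ t ℕ.* b)) 0) ⟨
  (∑[ i ∈ upTo b ] ∑-digits b n (λ s → ∑-digits M (ℕ.suc n) (λ t → F (s ℕ.+ t ℕ.* b)) 0) (k ℕ.+ i))
    ≡⟨ ∑-digits-suc b n (λ s → ∑-digits M (ℕ.suc n) (λ t → F (s ℕ.+ t ℕ.* b)) 0) k ⟨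
  ∑-digits b (ℕ.suc n) (λ s → ∑-digits M (ℕ.suc n) (λ t → F (s ℕ.+ t ℕ.* b)) 0) k
    ∎
  where
  open ≡-Reasoning
  G : ℕ → ℕ → ℤ
  G s j = ∑-digits M n (λ t → F (s ℕ.+ t ℕ.* b)) j
  regroup : ∀ k j b i x y → k ℕ.+ (j ℕ.* b ℕ.+ i) ℕ.+ x ℕ.+ y ℕ.* b ≡ k ℕ.+ i ℕ.+ x ℕ.+ (j ℕ.+ y) ℕ.* b
  regroup = ℕSolver.solve-∀
  carry : ∀ j i → ∑-digits b n (λ s → G s 0) (k ℕ.+ (j ℕ.* b ℕ.+ i)) ≡ ∑-digits b n (λ s → G s j) (k ℕ.+ i)
  carry j i = ∑-cong (words (upTo b) n) λ x → ∑-cong (words (upTo M) n) λ y →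
    cong F (regroup k j b i (Vec.sum x) (Vec.sum y))

-- Since ⌊(s + t b) / (M b)⌋ = ⌊(⌊s / b⌋ + t) / M⌋, the carry out of the low parts enters the
-- addition of the high parts.
∑-digits-carry : ∀ M b n F k .{{_ : NonZero M}} .{{_ : NonZero b}} .{{_ : NonZero (M ℕ.* b)}} →
  ∑-digits (M ℕ.* b) n (λ u → F (u ℕ./ (M ℕ.* b))) k ≡
  ∑-digits b n (λ s → ∑-digits M n (λ t → F (t ℕ./ M)) (s ℕ./ b)) k
∑-digits-carry M b n F k = trans
  (∑-digits-* M b n (λ u → F (u ℕ./ (M ℕ.* b))) k)
  (∑-cong (words (upTo b) n) λ x → ∑-cong (words (upTo M) n) λ y →
    cong F (divide (k ℕ.+ Vec.sum x) (Vec.sum y)))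
  where
  open ≡-Reasoning
  instance _ = ℕ.m*n≢0 b M
  divide : ∀ s t → (s ℕ.+ t ℕ.* b) ℕ./ (M ℕ.* b) ≡ (s ℕ./ b ℕ.+ t) ℕ./ M
  divide s t = begin
    (s ℕ.+ t ℕ.* b) ℕ./ (M ℕ.* b)             ≡⟨ ℕ./-congʳ (ℕ.*-comm M b) ⟩
    (s ℕ.+ t ℕ.* b) ℕ./ (b ℕ.* M)             ≡⟨ ℕ.m/n/o≡m/[n*o] (s ℕ.+ t ℕ.* b) b M ⟨
    (s ℕ.+ t ℕ.* b) ℕ./ b ℕ./ M               ≡⟨ ℕ./-congˡ {o = M} (ℕ.+-distrib-/-∣ʳ s (n∣m*n t)) ⟩
    (s ℕ./ b ℕ.+ t ℕ.* b ℕ./ b) ℕ./ M         ≡⟨ ℕ./-congˡ {o = M} (cong (s ℕ./ b ℕ.+_) (ℕ.m*n/n≡m t b)) ⟩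
    (s ℕ./ b ℕ.+ t) ℕ./ M                     ∎

∑-tabulate : ∀ {n} (h : Fin n → Ω) f → ∑ (tabulate h) f ≡ ∑ (allFin n) (f ∘ h)
∑-tabulate {n = n} h f = trans (cong (λ xs → ∑ xs f) (sym (List.map-tabulate id h))) (∑-map h (allFin n) f)

∑-allFin-toℕ : ∀ n (f : ℕ → ℤ) → ∑ (allFin n) (f ∘ toℕ) ≡ ∑ (upTo n) f
∑-allFin-toℕ ℕ.zero    f = refl
∑-allFin-toℕ (ℕ.suc n) f = begin
  f 0 + ∑ (tabulate {n = n} Fin.suc) (f ∘ toℕ)          ≡⟨ cong (_+_ (f 0)) (∑-tabulate {n = n} Fin.suc (f ∘ toℕ)) ⟩
  f 0 + ∑ (allFin n) (f ∘ ℕ.suc ∘ toℕ)          ≡⟨ cong (_+_ (f 0)) (∑-allFin-toℕ n (f ∘ ℕ.suc)) ⟩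
  f 0 + ∑ (upTo n) (f ∘ ℕ.suc)                  ≡⟨ ∑-upTo-suc n f ⟨
  ∑ (upTo (ℕ.suc n)) f                          ∎
  where open ≡-Reasoning

∑-words-toℕ : ∀ b n (f : Vec ℕ n → ℤ) → ∑ (words (allFin b) n) (f ∘ Vec.map toℕ) ≡ ∑ (words (upTo b) n) f
∑-words-toℕ b ℕ.zero    f = refl
∑-words-toℕ b (ℕ.suc n) f = begin
  ∑ (words (allFin b) (ℕ.suc n)) (f ∘ Vec.map toℕ)
    ≡⟨ ∑-words-suc (allFin b) n (f ∘ Vec.map toℕ) ⟩
  (∑[ d ∈ allFin b ] ∑[ x ∈ words (allFin b) n ] f (toℕ d ∷ Vec.map toℕ x))
    ≡⟨ ∑-cong (allFin b) (λ d → ∑-words-toℕ b n (λ x → f (toℕ d ∷ x))) ⟩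
  (∑[ d ∈ allFin b ] ∑[ x ∈ words (upTo b) n ] f (toℕ d ∷ x))
    ≡⟨ ∑-allFin-toℕ b (λ i → ∑[ x ∈ words (upTo b) n ] f (i ∷ x)) ⟩
  (∑[ i ∈ upTo b ] ∑[ x ∈ words (upTo b) n ] f (i ∷ x))
    ≡⟨ ∑-words-suc (upTo b) n f ⟨
  ∑ (words (upTo b) (ℕ.suc n)) f
    ∎
  where open ≡-Reasoning

∑-digitSum : ∀ b .{{_ : NonZero b}} n (F : ℕ → ℤ) k →
  (∑[ x ∈ words (allFin b) n ] F (k ℕ.+ digitSum b x)) ≡ ∑-digits b n F k
∑-digitSum b n F k = ∑-words-toℕ b n (λ x → F (k ℕ.+ Vec.sum x))

∑-digits-1 : ∀ n (F : ℕ → ℤ) k → ∑-digits 1 n F k ≡ F k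
∑-digits-1 ℕ.zero    F k = ∑-digits-zero 1 F k
∑-digits-1 (ℕ.suc n) F k = begin
  ∑-digits 1 (ℕ.suc n) F k          ≡⟨ ∑-digits-suc 1 n F k ⟩
  ∑-digits 1 n F (k ℕ.+ 0) + 0ℤ     ≡⟨ ℤ.+-identityʳ _ ⟩
  ∑-digits 1 n F (k ℕ.+ 0)          ≡⟨ cong (∑-digits 1 n F) (ℕ.+-identityʳ k) ⟩
  ∑-digits 1 n F k                  ≡⟨ ∑-digits-1 n F k ⟩
  F k                               ∎
  where open ≡-Reasoning

-- The first step is split off by `∑-digits-carry`. No step at all corresponds to base 1, whose only
-- digit is 0.
∑-run : ∀ b .{{_ : NonZero b}} n r (F : ℕ → ℤ) k .{{_ : NonZero (b ^ r)}} →
  (∑[ xs ∈ words (words (allFin b) n) r ] F (run b k xs)) ≡ ∑-digits (b ^ r) n (λ u → F (u ℕ./ (b ^ r))) k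
∑-run b n ℕ.zero    F k = begin
  F k + 0ℤ                           ≡⟨ ℤ.+-identityʳ (F k) ⟩
  F k                                ≡⟨ cong F (ℕ.n/1≡n k) ⟨
  F (k ℕ./ 1)                        ≡⟨ ∑-digits-1 n (λ u → F (u ℕ./ 1)) k ⟨
  ∑-digits 1 n (λ u → F (u ℕ./ 1)) k ∎
  where open ≡-Reasoning
∑-run b n (ℕ.suc r) F k = begin
  (∑[ xs ∈ words (words (allFin b) n) (ℕ.suc r) ] F (run b k xs))
    ≡⟨ ∑-words-suc (words (allFin b) n) r (λ xs → F (run b k xs)) ⟩
  (∑[ x ∈ words (allFin b) n ] ∑[ xs ∈ words (words (allFin b) n) r ] F (run b (step b k x) xs))
    ≡⟨ ∑-cong (words (allFin b) n) (λ x → ∑-run b n r F (step b k x)) ⟩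
  (∑[ x ∈ words (allFin b) n ] ∑-digits (b ^ r) n (λ u → F (u ℕ./ (b ^ r))) (step b k x))
    ≡⟨ ∑-digitSum b n (λ s → ∑-digits (b ^ r) n (λ u → F (u ℕ./ (b ^ r))) (s ℕ./ b)) k ⟩
  ∑-digits b n (λ s → ∑-digits (b ^ r) n (λ u → F (u ℕ./ (b ^ r))) (s ℕ./ b)) k
    ≡⟨ ∑-digits-carry (b ^ r) b n F k ⟨
  ∑-digits (b ^ r ℕ.* b) n (λ u → F (u ℕ./ (b ^ r ℕ.* b))) k
    ≡⟨ ∑-cong-base (ℕ.*-comm (b ^ r) b) ⟩
  ∑-digits (b ^ ℕ.suc r) n (λ u → F (u ℕ./ (b ^ ℕ.suc r))) k
    ∎
  where
  open ≡-Reasoning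
  instance
    _ = ℕ.m^n≢0 b r
    _ = ℕ.m*n≢0 (b ^ r) b
  -- With both bases generalised to variables, matching on `refl` also identifies the `NonZero`
  -- instances on which the divisions depend.
  ∑-cong-base : ∀ {M N} .{{_ : NonZero M}} .{{_ : NonZero N}} → M ≡ N →
    ∑-digits M n (λ u → F (u ℕ./ M)) k ≡ ∑-digits N n (λ u → F (u ℕ./ N)) k
  ∑-cong-base refl = refl

-- The sum for base M L is a sum over base-L words of the sum for base M started from their carry.
-- Each carry is compared with 0 by `digits-near`, and Cauchy-Schwarz averages over the words.
carries-near : ∀ {n} .{{_ : NonZero n}} {F : ℕ → ℤ} → (∀ k → F k * F k ≡ 1ℤ) →
  ∀ M L .{{_ : NonZero M}} .{{_ : NonZero L}} .{{_ : NonZero (M ℕ.* L)}} → 2 ℕ.≤ M →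
  let P = λ N .{{_ : NonZero N}} → ∑-digits N (ℕ.suc n) (λ u → F (u ℕ./ N)) 0
      Δ = P (M ℕ.* L) - + (L ^ ℕ.suc n) * P M
  in  Δ * Δ ≤ + (L ^ ℕ.suc n) * (+ (L ^ ℕ.suc n) * (+ n * (+ 32 * (+ (M ^ n) * + (M ^ n)))))
carries-near {n} {F} F²≡1 M L 2≤M = begin
  Δ * Δ
    ≡⟨ cong (λ z → z * z) average ⟩
  ∑ xs d * ∑ xs d
    ≤⟨ ∑-cauchy-schwarz xs d ⟩
  + length xs * (∑[ x ∈ xs ] d x * d x)
    ≤⟨ ℤ.*-monoˡ-≤-nonNeg (+ length xs) (∑-mono xs near) ⟩
  + length xs * (∑[ x ∈ xs ] C)
    ≡⟨ cong (+ length xs *_) (∑-const xs C) ⟩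
  + length xs * (+ length xs * C)
    ≡⟨ cong (λ l → + l * (+ l * C)) size ⟩
  + (L ^ ℕ.suc n) * (+ (L ^ ℕ.suc n) * C)
    ∎
  where
  open ℤ.≤-Reasoning
  xs = words (allFin L) (ℕ.suc n)
  D : ℕ → ℤ
  D = ∑-digits M (ℕ.suc n) (λ u → F (u ℕ./ M))
  d : Vec (Fin L) (ℕ.suc n) → ℤ
  d x = D (digitSum L x ℕ./ L) - D 0
  Δ C : ℤ
  Δ = ∑-digits (M ℕ.* L) (ℕ.suc n) (λ u → F (u ℕ./ (M ℕ.* L))) 0 - + (L ^ ℕ.suc n) * D 0
  C = + n * (+ 32 * (+ (M ^ n) * + (M ^ n)))
  size : length xs ≡ L ^ ℕ.suc n
  size = trans (length-words (allFin L) (ℕ.suc n)) (cong (_^ ℕ.suc n) (List.length-tabulate {n = L} id))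
  average : Δ ≡ ∑ xs d
  average = trans
    (cong₂ _-_
      (trans (∑-digits-carry M L (ℕ.suc n) F 0) (sym (∑-digitSum L (ℕ.suc n) (λ s → D (s ℕ./ L)) 0)))
      (trans (cong (λ l → + l * D 0) (sym size)) (sym (∑-const xs (D 0)))))
    (sym (∑-- xs (λ x → D (digitSum L x ℕ./ L)) (λ _ → D 0)))
  near : ∀ x → d x * d x ≤ C
  -- The carry of n + 1 digits is below n + 1, hence a shift by at most n.
  near x = digits-near {n} {λ u → F (u ℕ./ M)} (λ u → F²≡1 (u ℕ./ M)) M 2≤M (digitSum L x ℕ./ L)
    (ℕ.≤-pred (Carries.step-< L {k = 0} x (ℕ.s≤s ℕ.z≤n)))

-- Carries as descents of words

drop? : ℕ → ℕ → ℕ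
drop? a y = if y ℕ.<ᵇ a then 1 else 0

-- The sum of g (d + number of descents of a y₁ … yₙ) over all words y in [N]ⁿ.
∑-word-descents : (N n : ℕ) → (ℕ → ℤ) → ℕ → ℕ → ℤ
∑-word-descents N ℕ.zero    g a d = g d
∑-word-descents N (ℕ.suc n) g a d = ∑[ y ∈ upTo N ] ∑-word-descents N n g y (d ℕ.+ drop? a y)

-- The same sum over Lehmer codes, i.e. over y in [N] × [N - 1] × ⋯ × [N - n + 1].
∑-code-descents : (N n : ℕ) → (ℕ → ℤ) → ℕ → ℕ → ℤ
∑-code-descents N ℕ.zero    g a d = g d
∑-code-descents N (ℕ.suc n) g a d = ∑[ y ∈ upTo N ] ∑-code-descents (ℕ.pred N) n g y (d ℕ.+ drop? a y)

-- The residues y of a + i modulo N cover [0, N) once, and y < a exactly when a + i has reached N.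
∑-upTo-rotate : ∀ {a N} → a ℕ.≤ N → (f : ℕ → ℤ) →
  (∑[ i ∈ upTo N ] f (a ℕ.+ i)) ≡ (∑[ y ∈ upTo N ] f ((if y ℕ.<ᵇ a then N else 0) ℕ.+ y))
∑-upTo-rotate {a} {N} a≤N f = begin
  (∑[ i ∈ upTo N ] f (a ℕ.+ i))
    ≡⟨ cong (λ m → ∑[ i ∈ upTo m ] f (a ℕ.+ i)) (ℕ.m∸n+n≡m a≤N) ⟨
  (∑[ i ∈ upTo (c ℕ.+ a) ] f (a ℕ.+ i))
    ≡⟨ ∑-upTo-+ c a (λ i → f (a ℕ.+ i)) ⟩
  (∑[ i ∈ upTo c ] f (a ℕ.+ i)) + (∑[ i ∈ upTo a ] f (a ℕ.+ (c ℕ.+ i)))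
    ≡⟨ ℤ.+-comm (∑[ i ∈ upTo c ] f (a ℕ.+ i)) (∑[ i ∈ upTo a ] f (a ℕ.+ (c ℕ.+ i))) ⟩
  (∑[ i ∈ upTo a ] f (a ℕ.+ (c ℕ.+ i))) + (∑[ i ∈ upTo c ] f (a ℕ.+ i))
    ≡⟨ cong (_+ (∑[ i ∈ upTo c ] f (a ℕ.+ i))) (∑-cong (upTo a) λ i → cong f
         (trans (sym (ℕ.+-assoc a c i)) (cong (ℕ._+ i) (ℕ.m+[n∸m]≡n a≤N)))) ⟩
  (∑[ i ∈ upTo a ] f (N ℕ.+ i)) + (∑[ i ∈ upTo c ] f (a ℕ.+ i))
    ≡⟨ ∑-upTo-<ᵇ a c (λ y b → f ((if b then N else 0) ℕ.+ y)) ⟨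
  (∑[ y ∈ upTo (a ℕ.+ c) ] f ((if y ℕ.<ᵇ a then N else 0) ℕ.+ y))
    ≡⟨ cong (λ m → ∑[ y ∈ upTo m ] f ((if y ℕ.<ᵇ a then N else 0) ℕ.+ y)) (ℕ.m+[n∸m]≡n a≤N) ⟩
  (∑[ y ∈ upTo N ] f ((if y ℕ.<ᵇ a then N else 0) ℕ.+ y))
    ∎
  where
  open ≡-Reasoning
  c = N ℕ.∸ a

-- Passing to partial sums modulo N turns carries into descents.
carries-descents : ∀ N .{{_ : NonZero N}} n (g : ℕ → ℤ) {a} d → a ℕ.< N →
  ∑-digits N n (λ u → g (u ℕ./ N)) (d ℕ.* N ℕ.+ a) ≡ ∑-word-descents N n g a d
carries-descents N ℕ.zero    g {a} d a<N = trans (∑-digits-zero N (λ u → g (u ℕ./ N)) (d ℕ.* N ℕ.+ a)) (cong g (begin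
  (d ℕ.* N ℕ.+ a) ℕ./ N        ≡⟨ ℕ.+-distrib-/-∣ˡ a (n∣m*n d) ⟩
  d ℕ.* N ℕ./ N ℕ.+ a ℕ./ N    ≡⟨ cong₂ ℕ._+_ (ℕ.m*n/n≡m d N) (ℕ.m<n⇒m/n≡0 a<N) ⟩
  d ℕ.+ 0                      ≡⟨ ℕ.+-identityʳ d ⟩
  d                            ∎))
  where open ≡-Reasoning
carries-descents N (ℕ.suc n) g {a} d a<N = begin
  ∑-digits N (ℕ.suc n) G (d ℕ.* N ℕ.+ a)
    ≡⟨ ∑-digits-suc N n G (d ℕ.* N ℕ.+ a) ⟩
  (∑[ i ∈ upTo N ] ∑-digits N n G (d ℕ.* N ℕ.+ a ℕ.+ i))
    ≡⟨ ∑-cong (upTo N) (λ i → cong (∑-digits N n G) (ℕ.+-assoc (d ℕ.* N) a i)) ⟩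
  (∑[ i ∈ upTo N ] ∑-digits N n G (d ℕ.* N ℕ.+ (a ℕ.+ i)))
    ≡⟨ ∑-upTo-rotate (ℕ.<⇒≤ a<N) (λ j → ∑-digits N n G (d ℕ.* N ℕ.+ j)) ⟩
  (∑[ y ∈ upTo N ] ∑-digits N n G (d ℕ.* N ℕ.+ ((if y ℕ.<ᵇ a then N else 0) ℕ.+ y)))
    -- The partial sum reaches the next multiple of N exactly when its residue drops from a to some
    -- y < a; its quotient d then grows by one.
    ≡⟨ ∑-cong-All (All-upTo N λ {y} y<N → trans
         (cong (∑-digits N n G) (carry (y ℕ.<ᵇ a) y))
         (carries-descents N n g (d ℕ.+ drop? a y) y<N)) ⟩
  ∑-word-descents N (ℕ.suc n) g a d
    ∎
  where
  open ≡-Reasoning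
  G : ℕ → ℤ
  G u = g (u ℕ./ N)
  carry₁ : ∀ d N y → d ℕ.* N ℕ.+ (N ℕ.+ y) ≡ (d ℕ.+ 1) ℕ.* N ℕ.+ y
  carry₁ = ℕSolver.solve-∀
  carry : ∀ b y → d ℕ.* N ℕ.+ ((if b then N else 0) ℕ.+ y) ≡ (d ℕ.+ (if b then 1 else 0)) ℕ.* N ℕ.+ y
  carry true  y = carry₁ d N y
  carry false y = cong (λ e → e ℕ.* N ℕ.+ y) (sym (ℕ.+-identityʳ d))

-- Injective words: their number and the role of the alphabet

falling : ℕ → ℕ → ℕ
falling N ℕ.zero    = 1
falling N (ℕ.suc n) = N ℕ.* falling (ℕ.pred N) n

falling-self : ∀ n → falling n n ≡ n !
falling-self ℕ.zero    = refl
falling-self (ℕ.suc n) = cong (ℕ.suc n ℕ.*_) (falling-self n)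

-- Put M = N + m. A word of n letters below M avoids m given letters and all repetitions, except
-- with probability at most n (m + n) / M. The induction lowers N and raises m, so M stays fixed.
falling-near-power : ∀ m N n → (N ℕ.+ m) ℕ.* (N ℕ.+ m) ^ n ℕ.≤ (N ℕ.+ m) ℕ.* falling N n ℕ.+ n ℕ.* (m ℕ.+ n) ℕ.* (N ℕ.+ m) ^ n
falling-near-power m N          ℕ.zero    = ℕ.m≤m+n _ 0
falling-near-power m ℕ.zero     (ℕ.suc n) = begin
  m ℕ.* (m ℕ.* m ^ n)                                              ≤⟨ ℕ.*-monoˡ-≤ (m ℕ.* m ^ n) (ℕ.≤-trans (ℕ.m≤m+n m (ℕ.suc n)) (ℕ.m≤n*m (m ℕ.+ ℕ.suc n) (ℕ.suc n))) ⟩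
  ℕ.suc n ℕ.* (m ℕ.+ ℕ.suc n) ℕ.* (m ℕ.* m ^ n)                    ≤⟨ ℕ.m≤n+m _ _ ⟩
  m ℕ.* 0 ℕ.+ ℕ.suc n ℕ.* (m ℕ.+ ℕ.suc n) ℕ.* (m ℕ.* m ^ n)        ∎
  where open ℕ.≤-Reasoning
falling-near-power m (ℕ.suc N) (ℕ.suc n) = begin
  M ℕ.* (M ℕ.* Q)
    ≡⟨ split (ℕ.suc N) m (M ℕ.* Q) ⟩
  ℕ.suc N ℕ.* (M ℕ.* Q) ℕ.+ m ℕ.* (M ℕ.* Q)
    ≤⟨ ℕ.+-monoˡ-≤ (m ℕ.* (M ℕ.* Q)) (ℕ.*-monoʳ-≤ (ℕ.suc N) (subst (λ k → k ℕ.* k ^ n ℕ.≤ k ℕ.* falling N n ℕ.+ n ℕ.* (ℕ.suc m ℕ.+ n) ℕ.* k ^ n) (ℕ.+-suc N m) (falling-near-power (ℕ.suc m) N n))) ⟩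
  ℕ.suc N ℕ.* (M ℕ.* R ℕ.+ c ℕ.* Q) ℕ.+ m ℕ.* (M ℕ.* Q)
    ≡⟨ cong (ℕ._+ m ℕ.* (M ℕ.* Q)) (ℕ.*-distribˡ-+ (ℕ.suc N) (M ℕ.* R) (c ℕ.* Q)) ⟩
  ℕ.suc N ℕ.* (M ℕ.* R) ℕ.+ ℕ.suc N ℕ.* (c ℕ.* Q) ℕ.+ m ℕ.* (M ℕ.* Q)
    ≤⟨ ℕ.+-monoˡ-≤ (m ℕ.* (M ℕ.* Q)) (ℕ.+-monoʳ-≤ (ℕ.suc N ℕ.* (M ℕ.* R)) (ℕ.*-monoˡ-≤ (c ℕ.* Q) (ℕ.m≤m+n (ℕ.suc N) m))) ⟩
  ℕ.suc N ℕ.* (M ℕ.* R) ℕ.+ M ℕ.* (c ℕ.* Q) ℕ.+ m ℕ.* (M ℕ.* Q)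
    ≤⟨ ℕ.m≤m+n _ (ℕ.suc n ℕ.* (M ℕ.* Q)) ⟩
  ℕ.suc N ℕ.* (M ℕ.* R) ℕ.+ M ℕ.* (c ℕ.* Q) ℕ.+ m ℕ.* (M ℕ.* Q) ℕ.+ ℕ.suc n ℕ.* (M ℕ.* Q)
    ≡⟨ collect N n m M Q R ⟩
  M ℕ.* (ℕ.suc N ℕ.* R) ℕ.+ ℕ.suc n ℕ.* (m ℕ.+ ℕ.suc n) ℕ.* (M ℕ.* Q)
    ∎
  where
  open ℕ.≤-Reasoning
  M = ℕ.suc N ℕ.+ m
  Q = M ^ n
  R = falling N n
  c = n ℕ.* (ℕ.suc m ℕ.+ n)
  split : ∀ a b q → (a ℕ.+ b) ℕ.* q ≡ a ℕ.* q ℕ.+ b ℕ.* q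
  split = ℕSolver.solve-∀
  collect : ∀ N n m M Q R →
    (1 ℕ.+ N) ℕ.* (M ℕ.* R) ℕ.+ M ℕ.* (n ℕ.* (1 ℕ.+ m ℕ.+ n) ℕ.* Q) ℕ.+ m ℕ.* (M ℕ.* Q) ℕ.+ (1 ℕ.+ n) ℕ.* (M ℕ.* Q) ≡
    M ℕ.* ((1 ℕ.+ N) ℕ.* R) ℕ.+ (1 ℕ.+ n) ℕ.* (m ℕ.+ (1 ℕ.+ n)) ℕ.* (M ℕ.* Q)
  collect = ℕSolver.solve-∀

∣∑∣-bound : ∀ {xs : List Ω} {f c} → All (λ x → ∣ f x ∣ ℕ.≤ c) xs → ∣ ∑ xs f ∣ ℕ.≤ length xs ℕ.* c
∣∑∣-bound []                   = ℕ.z≤n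
∣∑∣-bound {f = f} (_∷_ {x} {xs} p ps) = ℕ.≤-trans (ℤ.∣i+j∣≤∣i∣+∣j∣ (f x) (∑ xs f)) (ℕ.+-mono-≤ p (∣∑∣-bound ps))

∣∑-upTo∣-bound : ∀ n {f : ℕ → ℤ} {c} → (∀ y → ∣ f y ∣ ℕ.≤ c) → ∣ ∑ (upTo n) f ∣ ℕ.≤ n ℕ.* c
∣∑-upTo∣-bound n {f} {c} f≤c = subst (λ l → ∣ ∑ (upTo n) f ∣ ℕ.≤ l ℕ.* c) (List.length-upTo n)
  (∣∑∣-bound {xs = upTo n} {f} (All.universal f≤c (upTo n)))

module _ {g : ℕ → ℤ} (g≤1 : ∀ d → ∣ g d ∣ ℕ.≤ 1) where

  ∣word-descents∣ : ∀ N n a d → ∣ ∑-word-descents N n g a d ∣ ℕ.≤ N ^ n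
  ∣word-descents∣ N ℕ.zero    a d = g≤1 d
  ∣word-descents∣ N (ℕ.suc n) a d = ∣∑-upTo∣-bound N λ y → ∣word-descents∣ N n y (d ℕ.+ drop? a y)

  ∣code-descents∣ : ∀ N n a d → ∣ ∑-code-descents N n g a d ∣ ℕ.≤ falling N n
  ∣code-descents∣ N ℕ.zero    a d = g≤1 d
  ∣code-descents∣ N (ℕ.suc n) a d = ∣∑-upTo∣-bound N λ y → ∣code-descents∣ (ℕ.pred N) n y (d ℕ.+ drop? a y)

  -- The codes form a sub-box of all words, with the same summand; the difference is thus a sum of g
  -- over the words outside the box. Adding `falling` on the left avoids truncated subtraction.
  word-code-near : ∀ N m n a d →
    ∣ ∑-word-descents (N ℕ.+ m) n g a d - ∑-code-descents N n g a d ∣ ℕ.+ falling N n ℕ.≤ (N ℕ.+ m) ^ n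
  word-code-near N         m ℕ.zero    a d = ℕ.≤-reflexive (cong (λ z → ∣ z ∣ ℕ.+ 1) (ℤ.+-inverseʳ (g d)))
  word-code-near ℕ.zero    m (ℕ.suc n) a d = subst (ℕ._≤ m ^ ℕ.suc n)
    (trans (cong ∣_∣ (sym (ℤ.+-identityʳ (∑-word-descents m (ℕ.suc n) g a d)))) (sym (ℕ.+-identityʳ _)))
    (∣word-descents∣ m (ℕ.suc n) a d)
  word-code-near (ℕ.suc N) m (ℕ.suc n) a d = begin
    ∣ ∑-word-descents M (ℕ.suc n) g a d - ∑ (upTo (ℕ.suc N)) K ∣ ℕ.+ ℕ.suc N ℕ.* R
      ≡⟨ cong (λ z → ∣ z ∣ ℕ.+ ℕ.suc N ℕ.* R) difference ⟩
    ∣ (∑[ y ∈ upTo (ℕ.suc N) ] V y - K y) + (∑[ y ∈ upTo m ] V (ℕ.suc N ℕ.+ y)) ∣ ℕ.+ ℕ.suc N ℕ.* R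
      ≤⟨ ℕ.+-monoˡ-≤ (ℕ.suc N ℕ.* R) (ℕ.≤-trans
           (ℤ.∣i+j∣≤∣i∣+∣j∣ (∑[ y ∈ upTo (ℕ.suc N) ] V y - K y) (∑[ y ∈ upTo m ] V (ℕ.suc N ℕ.+ y)))
           (ℕ.+-mono-≤ (∣∑-upTo∣-bound (ℕ.suc N) {λ y → V y - K y} near)
                       (∣∑-upTo∣-bound m {λ y → V (ℕ.suc N ℕ.+ y)} λ y → ∣word-descents∣ M n (ℕ.suc N ℕ.+ y) (d ℕ.+ drop? a (ℕ.suc N ℕ.+ y))))) ⟩
    ℕ.suc N ℕ.* (Q ℕ.∸ R) ℕ.+ m ℕ.* Q ℕ.+ ℕ.suc N ℕ.* R
      ≡⟨ collect (ℕ.suc N) m Q R (Q ℕ.∸ R) ⟩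
    ℕ.suc N ℕ.* (Q ℕ.∸ R ℕ.+ R) ℕ.+ m ℕ.* Q
      ≡⟨ cong (λ q → ℕ.suc N ℕ.* q ℕ.+ m ℕ.* Q) (ℕ.m∸n+n≡m (ℕ.m+n≤o⇒n≤o ∣ V 0 - K 0 ∣ (IH 0))) ⟩
    ℕ.suc N ℕ.* Q ℕ.+ m ℕ.* Q
      ≡⟨ ℕ.*-distribʳ-+ Q (ℕ.suc N) m ⟨
    M ℕ.* Q
      ∎
    where
    open ℕ.≤-Reasoning
    M = ℕ.suc N ℕ.+ m
    Q = M ^ n
    R = falling N n
    V K : ℕ → ℤ
    V y = ∑-word-descents M n g y (d ℕ.+ drop? a y)
    K y = ∑-code-descents N n g y (d ℕ.+ drop? a y)
    IH : ∀ y → ∣ V y - K y ∣ ℕ.+ R ℕ.≤ Q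
    IH y = subst (λ k → ∣ ∑-word-descents k n g y (d ℕ.+ drop? a y) - K y ∣ ℕ.+ R ℕ.≤ k ^ n) (ℕ.+-suc N m)
      (word-code-near N (ℕ.suc m) n y (d ℕ.+ drop? a y))
    near : ∀ y → ∣ V y - K y ∣ ℕ.≤ Q ℕ.∸ R
    near y = ℕ.m+n≤o⇒m≤o∸n _ (IH y)
    collect : ∀ s m q r e → s ℕ.* e ℕ.+ m ℕ.* q ℕ.+ s ℕ.* r ≡ s ℕ.* (e ℕ.+ r) ℕ.+ m ℕ.* q
    collect = ℕSolver.solve-∀
    regroup : ∀ a b c → a + b - c ≡ a - c + b
    regroup = solve-∀
    difference : ∑-word-descents M (ℕ.suc n) g a d - ∑ (upTo (ℕ.suc N)) K ≡
      (∑[ y ∈ upTo (ℕ.suc N) ] V y - K y) + (∑[ y ∈ upTo m ] V (ℕ.suc N ℕ.+ y))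
    difference = trans
      (cong (_- ∑ (upTo (ℕ.suc N)) K) (∑-upTo-+ (ℕ.suc N) m V))
      (trans (regroup (∑ (upTo (ℕ.suc N)) V) (∑[ y ∈ upTo m ] V (ℕ.suc N ℕ.+ y)) (∑ (upTo (ℕ.suc N)) K))
        (cong (_+ (∑[ y ∈ upTo m ] V (ℕ.suc N ℕ.+ y))) (sym (∑-- (upTo (ℕ.suc N)) V K))))

-- Inserting an unused letter into an injective word leaves its descents alone
-- and raises the first letter iff it is inserted below that letter;
-- here a is the first letter and the code is that of the remaining n letters.
code-insertion : ∀ N n (g : ℕ → ℤ) a d →
  (+ ℕ.suc N - + n) * ∑-code-descents (ℕ.suc N) n g a d ≡
  + a * ∑-code-descents N n g (ℕ.pred a) d + (+ ℕ.suc N - + a) * ∑-code-descents N n g a d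
code-insertion N ℕ.zero g a d = lemma (+ ℕ.suc N) (+ a) (g d)
  where
  lemma : ∀ m a x → (m - 0ℤ) * x ≡ a * x + (m - a) * x
  lemma = solve-∀
-- The right side has empty code ranges. The left side vanishes by its factor here, and by an empty
-- code range in the next clause.
code-insertion ℕ.zero (ℕ.suc ℕ.zero) g a d = lemma (+ a) (∑-code-descents 1 1 g a d)
  where
  lemma : ∀ a x → (1ℤ - 1ℤ) * x ≡ a * 0ℤ + (1ℤ - a) * 0ℤ
  lemma = solve-∀
code-insertion ℕ.zero (ℕ.suc (ℕ.suc n)) g a d = lemma (+ ℕ.suc (ℕ.suc n)) (+ a)
  where
  lemma : ∀ n a → (1ℤ - n) * 0ℤ ≡ a * 0ℤ + (1ℤ - a) * 0ℤ
  lemma = solve-∀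
code-insertion N@(ℕ.suc N′) (ℕ.suc n) g a d = begin
  (+ ℕ.suc N - + ℕ.suc n) * ∑-code-descents (ℕ.suc N) (ℕ.suc n) g a d
    ≡⟨ cong (_* ∑-code-descents (ℕ.suc N) (ℕ.suc n) g a d) (cancel-1 (+ N) (+ n)) ⟩
  (+ N - + n) * (∑[ y ∈ upTo (ℕ.suc N) ] ∑-code-descents N n g y (e y))
    ≡⟨ ∑-*ˡ (+ N - + n) (upTo (ℕ.suc N)) (λ y → ∑-code-descents N n g y (e y)) ⟨
  (∑[ y ∈ upTo (ℕ.suc N) ] (+ N - + n) * ∑-code-descents N n g y (e y))
    ≡⟨ ∑-cong (upTo (ℕ.suc N)) (λ y → code-insertion N′ n g y (e y)) ⟩
  (∑[ y ∈ upTo (ℕ.suc N) ] + y * K (ℕ.pred y) (e y) + (+ N - + y) * K y (e y))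
    ≡⟨ ∑-+ (upTo (ℕ.suc N)) (λ y → + y * K (ℕ.pred y) (e y)) (λ y → (+ N - + y) * K y (e y)) ⟩
  (∑[ y ∈ upTo (ℕ.suc N) ] + y * K (ℕ.pred y) (e y)) + (∑[ y ∈ upTo (ℕ.suc N) ] (+ N - + y) * K y (e y))
    -- The first sum loses its term at y = 0 and the second its term at y = N, both with coefficient
    -- 0. Afterwards both involve `K y` for y below N.
    ≡⟨ cong₂ _+_ (∑-upTo-suc N (λ y → + y * K (ℕ.pred y) (e y))) (∑-upTo-last N (λ y → (+ N - + y) * K y (e y))) ⟩
  0ℤ * K 0 (e 0) + (∑[ y ∈ upTo N ] + ℕ.suc y * K y (e (ℕ.suc y))) + ((∑[ y ∈ upTo N ] (+ N - + y) * K y (e y)) + (+ N - + N) * K N (e N))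
    ≡⟨ drop-ends (K 0 (e 0)) (∑[ y ∈ upTo N ] + ℕ.suc y * K y (e (ℕ.suc y))) (∑[ y ∈ upTo N ] (+ N - + y) * K y (e y)) (+ N) (K N (e N)) ⟩
  (∑[ y ∈ upTo N ] + ℕ.suc y * K y (e (ℕ.suc y))) + (∑[ y ∈ upTo N ] (+ N - + y) * K y (e y))
    ≡⟨ ∑-+ (upTo N) (λ y → + ℕ.suc y * K y (e (ℕ.suc y))) (λ y → (+ N - + y) * K y (e y)) ⟨
  (∑[ y ∈ upTo N ] + ℕ.suc y * K y (e (ℕ.suc y)) + (+ N - + y) * K y (e y))
    ≡⟨ ∑-cong (upTo N) (pointwise a) ⟩
  (∑[ y ∈ upTo N ] + a * K y (d ℕ.+ drop? (ℕ.pred a) y) + (+ ℕ.suc N - + a) * K y (e y))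
    ≡⟨ ∑-+ (upTo N) (λ y → + a * K y (d ℕ.+ drop? (ℕ.pred a) y)) (λ y → (+ ℕ.suc N - + a) * K y (e y)) ⟩
  (∑[ y ∈ upTo N ] + a * K y (d ℕ.+ drop? (ℕ.pred a) y)) + (∑[ y ∈ upTo N ] (+ ℕ.suc N - + a) * K y (e y))
    ≡⟨ cong₂ _+_ (∑-*ˡ (+ a) (upTo N) (λ y → K y (d ℕ.+ drop? (ℕ.pred a) y)))
                 (∑-*ˡ (+ ℕ.suc N - + a) (upTo N) (λ y → K y (e y))) ⟩
  + a * ∑-code-descents N (ℕ.suc n) g (ℕ.pred a) d + (+ ℕ.suc N - + a) * ∑-code-descents N (ℕ.suc n) g a d
    ∎
  where
  open ≡-Reasoning
  e : ℕ → ℕ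
  e y = d ℕ.+ drop? a y
  K : ℕ → ℕ → ℤ
  K y = ∑-code-descents N′ n g y
  cancel-1 : ∀ m n → 1ℤ + m - (1ℤ + n) ≡ m - n
  cancel-1 = solve-∀
  drop-ends : ∀ x s t m y → 0ℤ * x + s + (t + (m - m) * y) ≡ s + t
  drop-ends = solve-∀
  exchange : ∀ a y m x → (1ℤ + y) * x + (m - y) * x ≡ a * x + (1ℤ + m - a) * x
  exchange = solve-∀
  -- Where all drops agree only the total coefficient matters, which is N + 1 on both sides. They
  -- disagree only at y = a - 1, where the coefficients match term by term.
  pointwise : ∀ a y → + ℕ.suc y * K y (d ℕ.+ drop? a (ℕ.suc y)) + (+ N - + y) * K y (d ℕ.+ drop? a y) ≡
                      + a * K y (d ℕ.+ drop? (ℕ.pred a) y) + (+ ℕ.suc N - + a) * K y (d ℕ.+ drop? a y)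
  pointwise ℕ.zero    y = exchange 0ℤ (+ y) (+ N) (K y (d ℕ.+ 0))
  pointwise (ℕ.suc a) y with ℕ.<-cmp y a
  ... | tri< y<a _ _ rewrite <⇒<ᵇ≡true y<a | <⇒<ᵇ≡true (ℕ.m<n⇒m<1+n y<a) =
    exchange (+ ℕ.suc a) (+ y) (+ N) (K y (d ℕ.+ 1))
  ... | tri≈ _ refl _ = cong (λ c → + ℕ.suc a * K y (d ℕ.+ drop? a y) + c * K y (d ℕ.+ drop? (ℕ.suc a) y)) (sym (cancel-1 (+ N) (+ y)))
  ... | tri> _ _ a<y rewrite ≥⇒<ᵇ≡false (ℕ.<⇒≤ a<y) | ≥⇒<ᵇ≡false a<y =
    exchange (+ ℕ.suc a) (+ y) (+ N) (K y (d ℕ.+ 0))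

-- For a = 0 a recursion in the size of the alphabet remains, and its coefficients do not depend on
-- g.
code-insertion₀ : ∀ m n (g : ℕ → ℤ) →
  + ℕ.suc m * ∑-code-descents (ℕ.suc m ℕ.+ n) n g 0 0 ≡ + (ℕ.suc m ℕ.+ n) * ∑-code-descents (m ℕ.+ n) n g 0 0
code-insertion₀ m n g = begin
  + ℕ.suc m * ∑-code-descents (ℕ.suc m ℕ.+ n) n g 0 0
    ≡⟨ cong (_* ∑-code-descents (ℕ.suc m ℕ.+ n) n g 0 0) (subtract (+ ℕ.suc m) (+ n)) ⟩
  (+ (ℕ.suc m ℕ.+ n) - + n) * ∑-code-descents (ℕ.suc m ℕ.+ n) n g 0 0
    ≡⟨ code-insertion (m ℕ.+ n) n g 0 0 ⟩
  0ℤ * ∑-code-descents (m ℕ.+ n) n g 0 0 + (+ (ℕ.suc m ℕ.+ n) - 0ℤ) * ∑-code-descents (m ℕ.+ n) n g 0 0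
    ≡⟨ simplify (∑-code-descents (m ℕ.+ n) n g 0 0) (+ (ℕ.suc m ℕ.+ n)) ⟩
  + (ℕ.suc m ℕ.+ n) * ∑-code-descents (m ℕ.+ n) n g 0 0
    ∎
  where
  open ≡-Reasoning
  subtract : ∀ m n → m ≡ m + n - n
  subtract = solve-∀
  simplify : ∀ x c → 0ℤ * x + (c - 0ℤ) * x ≡ c * x
  simplify = solve-∀

∑-code-1 : ∀ N n a d → ∑-code-descents N n (λ _ → 1ℤ) a d ≡ + falling N n
∑-code-1 N ℕ.zero    a d = refl
∑-code-1 N (ℕ.suc n) a d = begin
  (∑[ y ∈ upTo N ] ∑-code-descents (ℕ.pred N) n (λ _ → 1ℤ) y (d ℕ.+ drop? a y))
    ≡⟨ ∑-cong (upTo N) (λ y → ∑-code-1 (ℕ.pred N) n y (d ℕ.+ drop? a y)) ⟩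
  (∑[ y ∈ upTo N ] + falling (ℕ.pred N) n)
    ≡⟨ ∑-const (upTo N) (+ falling (ℕ.pred N) n) ⟩
  + length (upTo N) * + falling (ℕ.pred N) n
    ≡⟨ cong (λ l → + l * + falling (ℕ.pred N) n) (List.length-upTo N) ⟩
  + N * + falling (ℕ.pred N) n
    ≡⟨ ℤ.pos-* N (falling (ℕ.pred N) n) ⟨
  + falling N (ℕ.suc n)
    ∎
  where open ≡-Reasoning

-- Solutions of one first-order recursion have a constant ratio, stated here by
-- cross-multiplication.
proportional : ∀ (x y : ℕ → ℤ) (c : ℕ → ℤ) →
  (∀ m → + ℕ.suc m * x (ℕ.suc m) ≡ c m * x m) → (∀ m → + ℕ.suc m * y (ℕ.suc m) ≡ c m * y m) →
  ∀ m → x m * y 0 ≡ y m * x 0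
proportional x y c x-rec y-rec ℕ.zero    = ℤ.*-comm (x 0) (y 0)
proportional x y c x-rec y-rec (ℕ.suc m) = ℤ.*-cancelˡ-≡ (+ ℕ.suc m) _ _ (begin
  + ℕ.suc m * (x (ℕ.suc m) * y 0)    ≡⟨ ℤ.*-assoc (+ ℕ.suc m) (x (ℕ.suc m)) (y 0) ⟨
  + ℕ.suc m * x (ℕ.suc m) * y 0      ≡⟨ cong (_* y 0) (x-rec m) ⟩
  c m * x m * y 0                    ≡⟨ ℤ.*-assoc (c m) (x m) (y 0) ⟩
  c m * (x m * y 0)                  ≡⟨ cong (c m *_) (proportional x y c x-rec y-rec m) ⟩
  c m * (y m * x 0)                  ≡⟨ ℤ.*-assoc (c m) (y m) (x 0) ⟨
  c m * y m * x 0                    ≡⟨ cong (_* x 0) (y-rec m) ⟨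
  + ℕ.suc m * y (ℕ.suc m) * x 0      ≡⟨ ℤ.*-assoc (+ ℕ.suc m) (y (ℕ.suc m)) (x 0) ⟩
  + ℕ.suc m * (y (ℕ.suc m) * x 0)    ∎)
  where open ≡-Reasoning

-- As g and the constant 1 obey the same recursion, the average of g over the codes is the same for
-- all alphabets. For m = 0 these are the codes of permutations.
code-descents-scaling : ∀ m n (g : ℕ → ℤ) →
  ∑-code-descents (m ℕ.+ n) n g 0 0 * + (n !) ≡ + falling (m ℕ.+ n) n * ∑-code-descents n n g 0 0
code-descents-scaling m n g = subst₂ (λ u v → x m * u ≡ v * x 0)
  (trans (∑-code-1 n n 0 0) (cong +_ (falling-self n))) (∑-code-1 (m ℕ.+ n) n 0 0)
  (proportional x (λ m → ∑-code-descents (m ℕ.+ n) n (λ _ → 1ℤ) 0 0) (λ m → + (ℕ.suc m ℕ.+ n))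
    (λ m → code-insertion₀ m n g) (λ m → code-insertion₀ m n (λ _ → 1ℤ)) m)
  where
  x : ℕ → ℤ
  x m = ∑-code-descents (m ℕ.+ n) n g 0 0

-- Lehmer codes of injective words

𝟙-∧ : ∀ a b → 𝟙 (a ∧ b) ≡ 𝟙 a * 𝟙 b
𝟙-∧ true  b = sym (ℤ.*-identityˡ (𝟙 b))
𝟙-∧ false b = sym (ℤ.*-zeroˡ (𝟙 b))

-- Written so that `does (unique? (x ∷ w))` reduces to `fresh x w ∧ does (unique? w)`.
fresh : ∀ {n k} → Fin n → Vec (Fin n) k → Bool
fresh x w = does (VecAll.all? (λ y → ¬? (x Fin.≟ y)) w)

-- Reindexing along `punchIn x`, which skips x, turns freshness into a smaller alphabet.
∑-fresh-letter : ∀ {n} (x : Fin (ℕ.suc n)) (f : Fin (ℕ.suc n) → ℤ) →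
  (∑[ y ∈ allFin (ℕ.suc n) ] 𝟙 (not (does (x Fin.≟ y))) * f y) ≡ (∑[ y ∈ allFin n ] f (punchIn x y))
∑-fresh-letter {n} Fin.zero f = begin
  0ℤ * f Fin.zero + ∑ (tabulate {n = n} Fin.suc) (λ y → 𝟙 (not (does (Fin.zero Fin.≟ y))) * f y)
    ≡⟨ cong₂ _+_ (ℤ.*-zeroˡ (f Fin.zero)) (∑-tabulate {n = n} Fin.suc (λ y → 𝟙 (not (does (Fin.zero Fin.≟ y))) * f y)) ⟩
  0ℤ + (∑[ y ∈ allFin n ] 1ℤ * f (Fin.suc y))
    ≡⟨ ℤ.+-identityˡ _ ⟩
  (∑[ y ∈ allFin n ] 1ℤ * f (Fin.suc y))
    ≡⟨ ∑-cong (allFin n) (λ y → ℤ.*-identityˡ (f (Fin.suc y))) ⟩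
  (∑[ y ∈ allFin n ] f (Fin.suc y))
    ∎
  where open ≡-Reasoning
∑-fresh-letter {ℕ.suc n} (Fin.suc x) f = begin
  1ℤ * f Fin.zero + ∑ (tabulate {n = ℕ.suc n} Fin.suc) (λ y → 𝟙 (not (does (Fin.suc x Fin.≟ y))) * f y)
    ≡⟨ cong₂ _+_ (ℤ.*-identityˡ (f Fin.zero)) (∑-tabulate {n = ℕ.suc n} Fin.suc (λ y → 𝟙 (not (does (Fin.suc x Fin.≟ y))) * f y)) ⟩
  f Fin.zero + (∑[ y ∈ allFin (ℕ.suc n) ] 𝟙 (not (does (x Fin.≟ y))) * f (Fin.suc y))
    ≡⟨ cong (_+_ (f Fin.zero)) (∑-fresh-letter x (f ∘ Fin.suc)) ⟩
  f Fin.zero + (∑[ y ∈ allFin n ] f (Fin.suc (punchIn x y)))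
    ≡⟨ cong (_+_ (f Fin.zero)) (∑-tabulate {n = n} Fin.suc (λ y → f (punchIn (Fin.suc x) y))) ⟨
  (∑[ y ∈ allFin (ℕ.suc n) ] f (punchIn (Fin.suc x) y))
    ∎
  where open ≡-Reasoning

∑-fresh-words : ∀ {n} (x : Fin (ℕ.suc n)) k (f : Vec (Fin (ℕ.suc n)) k → ℤ) →
  (∑[ w ∈ words (allFin (ℕ.suc n)) k ] 𝟙 (fresh x w) * f w) ≡ (∑[ w ∈ words (allFin n) k ] f (Vec.map (punchIn x) w))
∑-fresh-words x ℕ.zero    f = cong (_+ 0ℤ) (ℤ.*-identityˡ (f []))
∑-fresh-words {n} x (ℕ.suc k) f = begin
  (∑[ w ∈ words (allFin (ℕ.suc n)) (ℕ.suc k) ] 𝟙 (fresh x w) * f w)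
    ≡⟨ ∑-words-suc (allFin (ℕ.suc n)) k (λ w → 𝟙 (fresh x w) * f w) ⟩
  (∑[ y ∈ allFin (ℕ.suc n) ] ∑[ w ∈ ws ] 𝟙 (not (does (x Fin.≟ y)) ∧ fresh x w) * f (y ∷ w))
    ≡⟨ ∑-cong (allFin (ℕ.suc n)) (λ y → trans
         (∑-cong ws λ w → trans
           (cong (_* f (y ∷ w)) (𝟙-∧ (not (does (x Fin.≟ y))) (fresh x w)))
           (ℤ.*-assoc (𝟙 (not (does (x Fin.≟ y)))) (𝟙 (fresh x w)) (f (y ∷ w))))
         (∑-*ˡ (𝟙 (not (does (x Fin.≟ y)))) ws (λ w → 𝟙 (fresh x w) * f (y ∷ w)))) ⟩
  (∑[ y ∈ allFin (ℕ.suc n) ] 𝟙 (not (does (x Fin.≟ y))) * (∑[ w ∈ ws ] 𝟙 (fresh x w) * f (y ∷ w)))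
    ≡⟨ ∑-fresh-letter x (λ y → ∑[ w ∈ ws ] 𝟙 (fresh x w) * f (y ∷ w)) ⟩
  (∑[ y ∈ allFin n ] ∑[ w ∈ ws ] 𝟙 (fresh x w) * f (punchIn x y ∷ w))
    ≡⟨ ∑-cong (allFin n) (λ y → ∑-fresh-words x k (λ w → f (punchIn x y ∷ w))) ⟩
  (∑[ y ∈ allFin n ] ∑[ w ∈ words (allFin n) k ] f (punchIn x y ∷ Vec.map (punchIn x) w))
    ≡⟨ ∑-words-suc (allFin n) k (λ w → f (Vec.map (punchIn x) w)) ⟨
  (∑[ w ∈ words (allFin n) (ℕ.suc k) ] f (Vec.map (punchIn x) w))
    ∎
  where
  open ≡-Reasoning
  ws = words (allFin (ℕ.suc n)) k

fresh-punchIn : ∀ {n k} x (y : Fin n) (w : Vec (Fin n) k) → fresh (punchIn x y) (Vec.map (punchIn x) w) ≡ fresh y w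
fresh-punchIn x y []      = refl
fresh-punchIn x y (z ∷ w) = cong₂ (λ a b → not a ∧ b)
  (does-⇔ (mk⇔ (Fin.punchIn-injective x y z) (cong (punchIn x))) (punchIn x y Fin.≟ punchIn x z) (y Fin.≟ z))
  (fresh-punchIn x y w)

unique-punchIn : ∀ {n k} x (w : Vec (Fin n) k) → does (unique? (Vec.map (punchIn x) w)) ≡ does (unique? w)
unique-punchIn x []      = refl
unique-punchIn x (y ∷ w) = cong₂ _∧_ (fresh-punchIn x y w) (unique-punchIn x w)

<ᵇ-punchIn : ∀ {n} x (y z : Fin n) → (toℕ (punchIn x y) ℕ.<ᵇ toℕ (punchIn x z)) ≡ (toℕ y ℕ.<ᵇ toℕ z)
<ᵇ-punchIn Fin.zero    y           z           = refl
<ᵇ-punchIn (Fin.suc x) Fin.zero    Fin.zero    = refl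
<ᵇ-punchIn (Fin.suc x) Fin.zero    (Fin.suc z) = refl
<ᵇ-punchIn (Fin.suc x) (Fin.suc y) Fin.zero    = refl
<ᵇ-punchIn (Fin.suc x) (Fin.suc y) (Fin.suc z) = <ᵇ-punchIn x y z

-- Letters below x keep their value and the others move up past x, so a descent right after x
-- survives the relabelling.
punchIn-<ᵇ : ∀ {n} x (y : Fin n) → (toℕ (punchIn x y) ℕ.<ᵇ toℕ x) ≡ (toℕ y ℕ.<ᵇ toℕ x)
punchIn-<ᵇ Fin.zero    y           = refl
punchIn-<ᵇ (Fin.suc x) Fin.zero    = refl
punchIn-<ᵇ (Fin.suc x) (Fin.suc y) = punchIn-<ᵇ x y

-- The preceding letter is a bare number, since it belongs to a larger alphabet than w once its
-- value has been removed.
descentsFrom : ∀ {n k} → ℕ → Vec (Fin n) k → ℕ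
descentsFrom a []      = 0
descentsFrom a (y ∷ w) = drop? a (toℕ y) ℕ.+ descents (y ∷ w)

descents-∷ : ∀ {n k} (x : Fin n) (w : Vec (Fin n) k) → descents (x ∷ w) ≡ descentsFrom (toℕ x) w
descents-∷ x []      = refl
descents-∷ x (y ∷ w) = refl

descents-punchIn : ∀ {n k} x (w : Vec (Fin n) k) → descents (Vec.map (punchIn x) w) ≡ descents w
descents-punchIn x []          = refl
descents-punchIn x (y ∷ [])    = refl
descents-punchIn x (y ∷ z ∷ w) =
  cong₂ (λ b m → (if b then 1 else 0) ℕ.+ m) (<ᵇ-punchIn x z y) (descents-punchIn x (z ∷ w))

descentsFrom-punchIn : ∀ {n k} x (w : Vec (Fin n) k) → descentsFrom (toℕ x) (Vec.map (punchIn x) w) ≡ descentsFrom (toℕ x) w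
descentsFrom-punchIn x []      = refl
descentsFrom-punchIn x (y ∷ w) =
  cong₂ (λ b m → (if b then 1 else 0) ℕ.+ m) (punchIn-<ᵇ x y) (descents-punchIn x (y ∷ w))

-- What follows the first letter x avoids x. Closing the gap at x in the alphabet keeps all
-- descents, and the successive first letters form the Lehmer code.
∑-unique-words : ∀ N n (g : ℕ → ℤ) a d →
  (∑[ w ∈ words (allFin N) n ] 𝟙 (does (unique? w)) * g (d ℕ.+ descentsFrom a w)) ≡ ∑-code-descents N n g a d
∑-unique-words N         ℕ.zero    g a d =
  trans (ℤ.+-identityʳ _) (trans (ℤ.*-identityˡ (g (d ℕ.+ 0))) (cong g (ℕ.+-identityʳ d)))
∑-unique-words ℕ.zero    (ℕ.suc n) g a d = refl
∑-unique-words (ℕ.suc N) (ℕ.suc n) g a d = begin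
  (∑[ w ∈ words (allFin (ℕ.suc N)) (ℕ.suc n) ] 𝟙 (does (unique? w)) * g (d ℕ.+ descentsFrom a w))
    ≡⟨ ∑-words-suc (allFin (ℕ.suc N)) n (λ w → 𝟙 (does (unique? w)) * g (d ℕ.+ descentsFrom a w)) ⟩
  (∑[ x ∈ allFin (ℕ.suc N) ] ∑[ w ∈ ws ] 𝟙 (fresh x w ∧ does (unique? w)) * g (d ℕ.+ (drop? a (toℕ x) ℕ.+ descents (x ∷ w))))
    ≡⟨ ∑-cong (allFin (ℕ.suc N)) (λ x → ∑-cong ws (split x)) ⟩
  (∑[ x ∈ allFin (ℕ.suc N) ] ∑[ w ∈ ws ] 𝟙 (fresh x w) * h x w)
    ≡⟨ ∑-cong (allFin (ℕ.suc N)) (λ x → ∑-fresh-words x n (h x)) ⟩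
  (∑[ x ∈ allFin (ℕ.suc N) ] ∑[ w ∈ words (allFin N) n ] h x (Vec.map (punchIn x) w))
    ≡⟨ ∑-cong (allFin (ℕ.suc N)) (λ x → ∑-cong (words (allFin N) n) λ w →
         cong₂ (λ b m → 𝟙 b * g (d ℕ.+ drop? a (toℕ x) ℕ.+ m)) (unique-punchIn x w) (descentsFrom-punchIn x w)) ⟩
  (∑[ x ∈ allFin (ℕ.suc N) ] ∑[ w ∈ words (allFin N) n ] 𝟙 (does (unique? w)) * g (d ℕ.+ drop? a (toℕ x) ℕ.+ descentsFrom (toℕ x) w))
    ≡⟨ ∑-cong (allFin (ℕ.suc N)) (λ x → ∑-unique-words N n g (toℕ x) (d ℕ.+ drop? a (toℕ x))) ⟩
  (∑[ x ∈ allFin (ℕ.suc N) ] ∑-code-descents N n g (toℕ x) (d ℕ.+ drop? a (toℕ x)))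
    ≡⟨ ∑-allFin-toℕ (ℕ.suc N) (λ y → ∑-code-descents N n g y (d ℕ.+ drop? a y)) ⟩
  ∑-code-descents (ℕ.suc N) (ℕ.suc n) g a d
    ∎
  where
  open ≡-Reasoning
  ws = words (allFin (ℕ.suc N)) n
  h : ∀ {m} → Fin (ℕ.suc N) → Vec (Fin m) n → ℤ
  h x w = 𝟙 (does (unique? w)) * g (d ℕ.+ drop? a (toℕ x) ℕ.+ descentsFrom (toℕ x) w)
  split : ∀ x w → 𝟙 (fresh x w ∧ does (unique? w)) * g (d ℕ.+ (drop? a (toℕ x) ℕ.+ descents (x ∷ w))) ≡ 𝟙 (fresh x w) * h x w
  split x w = trans
    (cong₂ (λ p m → p * g m) (𝟙-∧ (fresh x w) (does (unique? w)))
      (trans (sym (ℕ.+-assoc d (drop? a (toℕ x)) (descents (x ∷ w)))) (cong (d ℕ.+ drop? a (toℕ x) ℕ.+_) (descents-∷ x w))))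
    (ℤ.*-assoc (𝟙 (fresh x w)) (𝟙 (does (unique? w))) (g (d ℕ.+ drop? a (toℕ x) ℕ.+ descentsFrom (toℕ x) w)))

-- The two laws as sums against a test function

count-∑ : ∀ {P : Ω → Set} (P? : Decidable P) xs → + count P? xs ≡ (∑[ x ∈ xs ] 𝟙 (does (P? x)))
count-∑ P? []       = refl
count-∑ P? (x ∷ xs) with does (P? x)
... | true  = cong (_+_ 1ℤ) (count-∑ P? xs)
... | false = trans (count-∑ P? xs) (sym (ℤ.+-identityˡ _))

∑-upTo-indicator : ∀ {m n} (σ : ℕ → ℤ) → m ℕ.< n → (∑[ j ∈ upTo n ] σ j * 𝟙 (does (m ℕ.≟ j))) ≡ σ m
∑-upTo-indicator {ℕ.zero} {ℕ.suc n} σ m<n = begin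
  (∑[ j ∈ upTo (ℕ.suc n) ] σ j * 𝟙 (does (0 ℕ.≟ j)))    ≡⟨ ∑-upTo-suc n (λ j → σ j * 𝟙 (does (0 ℕ.≟ j))) ⟩
  σ 0 * 1ℤ + (∑[ j ∈ upTo n ] σ (ℕ.suc j) * 0ℤ)         ≡⟨ cong₂ _+_ (ℤ.*-identityʳ (σ 0)) (∑-*ʳ 0ℤ (upTo n) (σ ∘ ℕ.suc)) ⟩
  σ 0 + ∑ (upTo n) (σ ∘ ℕ.suc) * 0ℤ                     ≡⟨ cong (_+_ (σ 0)) (ℤ.*-zeroʳ (∑ (upTo n) (σ ∘ ℕ.suc))) ⟩
  σ 0 + 0ℤ                                              ≡⟨ ℤ.+-identityʳ (σ 0) ⟩
  σ 0                                                   ∎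
  where open ≡-Reasoning
∑-upTo-indicator {ℕ.suc m} {ℕ.suc n} σ m<n = begin
  (∑[ j ∈ upTo (ℕ.suc n) ] σ j * 𝟙 (does (ℕ.suc m ℕ.≟ j)))         ≡⟨ ∑-upTo-suc n (λ j → σ j * 𝟙 (does (ℕ.suc m ℕ.≟ j))) ⟩
  σ 0 * 0ℤ + (∑[ j ∈ upTo n ] σ (ℕ.suc j) * 𝟙 (does (m ℕ.≟ j)))    ≡⟨ cong₂ _+_ (ℤ.*-zeroʳ (σ 0)) (∑-upTo-indicator (σ ∘ ℕ.suc) (ℕ.≤-pred m<n)) ⟩
  0ℤ + σ (ℕ.suc m)                                                 ≡⟨ ℤ.+-identityˡ (σ (ℕ.suc m)) ⟩
  σ (ℕ.suc m)                                                      ∎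
  where open ≡-Reasoning

∑-fibres : ∀ {n} (xs : List Ω) (q : Ω → ℤ) (f : Ω → ℕ) (σ : ℕ → ℤ) → (∀ x → f x ℕ.< n) →
  (∑[ j ∈ upTo n ] σ j * (∑[ x ∈ xs ] q x * 𝟙 (does (f x ℕ.≟ j)))) ≡ (∑[ x ∈ xs ] q x * σ (f x))
∑-fibres {n = n} xs q f σ f<n = begin
  (∑[ j ∈ upTo n ] σ j * (∑[ x ∈ xs ] q x * 𝟙 (does (f x ℕ.≟ j))))
    ≡⟨ ∑-cong (upTo n) (λ j → trans
         (sym (∑-*ˡ (σ j) xs (λ x → q x * 𝟙 (does (f x ℕ.≟ j)))))
         (∑-cong xs λ x → swap (σ j) (q x) (𝟙 (does (f x ℕ.≟ j))))) ⟩
  (∑[ j ∈ upTo n ] ∑[ x ∈ xs ] q x * (σ j * 𝟙 (does (f x ℕ.≟ j))))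
    ≡⟨ ∑-swap (upTo n) xs (λ j x → q x * (σ j * 𝟙 (does (f x ℕ.≟ j)))) ⟩
  (∑[ x ∈ xs ] ∑[ j ∈ upTo n ] q x * (σ j * 𝟙 (does (f x ℕ.≟ j))))
    ≡⟨ ∑-cong xs (λ x → trans
         (∑-*ˡ (q x) (upTo n) (λ j → σ j * 𝟙 (does (f x ℕ.≟ j))))
         (cong (q x *_) (∑-upTo-indicator σ (f<n x)))) ⟩
  (∑[ x ∈ xs ] q x * σ (f x))
    ∎
  where
  open ≡-Reasoning
  swap : ∀ a b c → a * (b * c) ≡ b * (a * c)
  swap = solve-∀

descents-< : ∀ {n k} (w : Vec (Fin n) (ℕ.suc k)) → descents w ℕ.< ℕ.suc k
descents-< (x ∷ [])    = ℕ.s≤s ℕ.z≤n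
descents-< (x ∷ y ∷ w) = ℕ.+-mono-≤-< (drop?≤1 (toℕ y ℕ.<ᵇ toℕ x)) (descents-< (y ∷ w))
  where
  drop?≤1 : ∀ b → (if b then 1 else 0) ℕ.≤ 1
  drop?≤1 true  = ℕ.≤-refl
  drop?≤1 false = ℕ.z≤n

-- Both sides are n ! times the expectation of σ under π.
∑-eulerian : ∀ n .{{_ : NonZero n}} (σ : ℕ → ℤ) → (∑[ j ∈ upTo n ] σ j * + A n j) ≡ ∑-code-descents n n σ 0 0
∑-eulerian n@(ℕ.suc n-1) σ = begin
  (∑[ j ∈ upTo n ] σ j * + A n j)
    ≡⟨ ∑-cong (upTo n) (λ j → cong (σ j *_) (trans
         (count-∑ (λ w → unique? w ×-dec (descents w ℕ.≟ j)) ws)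
         (∑-cong ws λ w → 𝟙-∧ (does (unique? w)) (does (descents w ℕ.≟ j))))) ⟩
  (∑[ j ∈ upTo n ] σ j * (∑[ w ∈ ws ] 𝟙 (does (unique? w)) * 𝟙 (does (descents w ℕ.≟ j))))
    ≡⟨ ∑-fibres ws (λ w → 𝟙 (does (unique? w))) descents σ descents-< ⟩
  (∑[ w ∈ ws ] 𝟙 (does (unique? w)) * σ (descents w))
    -- A letter 0 put in front of a word creates no descent.
    ≡⟨ ∑-cong ws (λ w → cong (λ m → 𝟙 (does (unique? w)) * σ m) (descents-0 w)) ⟩
  (∑[ w ∈ ws ] 𝟙 (does (unique? w)) * σ (descentsFrom 0 w))
    ≡⟨ ∑-unique-words n n σ 0 0 ⟩
  ∑-code-descents n n σ 0 0
    ∎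
  where
  open ≡-Reasoning
  ws = words (allFin n) n
  descents-0 : (w : Vec (Fin n) n) → descents w ≡ descentsFrom 0 w
  descents-0 (x ∷ w) = refl

-- Both sides are b ^ (n r) times the expectation of σ under the law after r steps.
∑-carries : ∀ b .{{_ : NonZero b}} n .{{_ : NonZero n}} r .{{_ : NonZero (b ^ r)}} (σ : ℕ → ℤ) →
  (∑[ j ∈ upTo n ] σ j * + count (λ xs → κ b xs ℕ.≟ j) (words (words (allFin b) n) r)) ≡
  ∑-digits (b ^ r) n (λ u → σ (u ℕ./ (b ^ r))) 0
∑-carries b n r σ = begin
  (∑[ j ∈ upTo n ] σ j * + count (λ xs → κ b xs ℕ.≟ j) ws)
    ≡⟨ ∑-cong (upTo n) (λ j → cong (σ j *_) (trans
         (count-∑ (λ xs → κ b xs ℕ.≟ j) ws)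
         (∑-cong ws λ xs → sym (ℤ.*-identityˡ (𝟙 (does (κ b xs ℕ.≟ j))))))) ⟩
  (∑[ j ∈ upTo n ] σ j * (∑[ xs ∈ ws ] 1ℤ * 𝟙 (does (κ b xs ℕ.≟ j))))
    ≡⟨ ∑-fibres ws (λ _ → 1ℤ) (κ b) σ (λ xs → Carries.run-< b xs (ℕ.>-nonZero⁻¹ n)) ⟩
  (∑[ xs ∈ ws ] 1ℤ * σ (κ b xs))
    ≡⟨ ∑-cong ws (λ xs → ℤ.*-identityˡ (σ (κ b xs))) ⟩
  (∑[ xs ∈ ws ] σ (κ b xs))
    ≡⟨ ∑-run b n r σ 0 ⟩
  ∑-digits (b ^ r) n (λ u → σ (u ℕ./ (b ^ r))) 0
    ∎
  where
  open ≡-Reasoning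
  ws = words (words (allFin b) n) r

-- Comparing carries with permutations

^-distribʳ-* : ∀ m n o → (m ℕ.* n) ^ o ≡ m ^ o ℕ.* n ^ o
^-distribʳ-* m n ℕ.zero    = refl
^-distribʳ-* m n (ℕ.suc o) = trans (cong (m ℕ.* n ℕ.*_) (^-distribʳ-* m n o)) (lemma m n (m ^ o) (n ^ o))
  where
  lemma : ∀ a b c d → a ℕ.* b ℕ.* (c ℕ.* d) ≡ a ℕ.* c ℕ.* (b ℕ.* d)
  lemma = ℕSolver.solve-∀

i*i≡∣i∣² : ∀ i → i * i ≡ + (∣ i ∣ ℕ.* ∣ i ∣)
i*i≡∣i∣² (+ n)    = sym (ℤ.pos-* n n)
i*i≡∣i∣² -[1+ n ] = refl

∣i∣≤c⇒i²≤c² : ∀ {i c} → ∣ i ∣ ℕ.≤ c → i * i ≤ + c * + c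
∣i∣≤c⇒i²≤c² {i} {c} le = subst₂ _≤_ (sym (i*i≡∣i∣² i)) (ℤ.pos-* c c) (ℤ.+≤+ (ℕ.*-mono-≤ le le))

-- A triangle inequality in squares, from ℓ γ = α - f M β. V, X and E stand for the sums for base M
-- L, base M and permutations, and n for the number of digits less one. The error α contributes 2 ·
-- 2² = 8 and β contributes 2 · 32 n; both fit into 72 (1 + n).
combine-errors : ∀ n M f P ℓ V X E → .{{ℤ.Positive ℓ}} → 0ℤ ≤ n →
  let N = ℓ * (M * P)
      α = M * (f * V - N * E)
      β = V - ℓ * X
      γ = M * (f * X - M * P * E)
      μ = f * (M * P)
  in α * α ≤ + 2 * (f * N) * (+ 2 * (f * N)) → β * β ≤ ℓ * (ℓ * (n * (+ 32 * (P * P)))) →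
     γ * γ ≤ + 72 * (1ℤ + n) * (μ * μ)
combine-errors n M f P ℓ V X E n≥0 α² β² = ℤ.*-cancelˡ-≤-pos _ _ ℓ (ℤ.*-cancelˡ-≤-pos _ _ ℓ (begin
  ℓ * (ℓ * (γ * γ))
    ≡⟨ decompose M f P ℓ V X E ⟩
  (α - f * M * β) * (α - f * M * β)
    ≤⟨ [i-j]²≤2[i²+j²] α (f * M * β) ⟩
  + 2 * (α * α + f * M * β * (f * M * β))
    ≡⟨ cong (λ z → + 2 * (α * α + z)) (regroup f M β) ⟩
  + 2 * (α * α + f * M * (f * M) * (β * β))
    ≤⟨ ℤ.*-monoˡ-≤-nonNeg (+ 2) (ℤ.+-mono-≤ α² (ℤ.*-monoˡ-≤-nonNeg (f * M * (f * M)) {{ℤ.nonNegative (0≤i*i (f * M))}} β²)) ⟩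
  + 2 * (+ 2 * (f * (ℓ * (M * P))) * (+ 2 * (f * (ℓ * (M * P)))) + f * M * (f * M) * (ℓ * (ℓ * (n * (+ 32 * (P * P))))))
    ≡⟨ collect n M f P ℓ ⟩
  ℓ * (ℓ * ((+ 8 + + 64 * n) * (μ * μ)))
    ≤⟨ ℤ.*-monoˡ-≤-nonNeg ℓ {{ℓ≥0}} (ℤ.*-monoˡ-≤-nonNeg ℓ {{ℓ≥0}} (ℤ.*-monoʳ-≤-nonNeg (μ * μ) {{ℤ.nonNegative (0≤i*i μ)}} slack)) ⟩
  ℓ * (ℓ * (+ 72 * (1ℤ + n) * (μ * μ)))
    ∎))
  where
  open ℤ.≤-Reasoning
  α β γ μ : ℤ
  α = M * (f * V - ℓ * (M * P) * E)
  β = V - ℓ * X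
  γ = M * (f * X - M * P * E)
  μ = f * (M * P)
  ℓ≥0 : ℤ.NonNegative ℓ
  ℓ≥0 = ℤ.nonNegative (ℤ.<⇒≤ (ℤ.positive⁻¹ ℓ))
  decompose : ∀ M f P ℓ V X E →
    ℓ * (ℓ * (M * (f * X - M * P * E) * (M * (f * X - M * P * E)))) ≡
    (M * (f * V - ℓ * (M * P) * E) - f * M * (V - ℓ * X)) * (M * (f * V - ℓ * (M * P) * E) - f * M * (V - ℓ * X))
  decompose M f P ℓ V X E = trans (square ℓ (M * (f * X - M * P * E))) (cong (λ z → z * z) (difference M f P ℓ V X E))
    where
    square : ∀ a b → a * (a * (b * b)) ≡ a * b * (a * b)
    square = solve-∀
    difference : ∀ M f P ℓ V X E → ℓ * (M * (f * X - M * P * E)) ≡ M * (f * V - ℓ * (M * P) * E) - f * M * (V - ℓ * X)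
    difference = solve-∀
  regroup : ∀ a b c → a * b * c * (a * b * c) ≡ a * b * (a * b) * (c * c)
  regroup = solve-∀
  collect : ∀ n M f P ℓ →
    + 2 * (+ 2 * (f * (ℓ * (M * P))) * (+ 2 * (f * (ℓ * (M * P)))) + f * M * (f * M) * (ℓ * (ℓ * (n * (+ 32 * (P * P)))))) ≡
    ℓ * (ℓ * ((+ 8 + + 64 * n) * (f * (M * P) * (f * (M * P)))))
  collect = solve-∀
  slack : + 8 + + 64 * n ≤ + 72 * (1ℤ + n)
  slack = ℤ.0≤i-j⇒j≤i (subst (0ℤ ≤_) (rewrite-slack n) (ℤ.+-mono-≤ {0ℤ} {+ 64} (ℤ.+≤+ ℕ.z≤n) (ℤ.*-monoˡ-≤-nonNeg (+ 8) n≥0)))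
    where
    rewrite-slack : ∀ n → + 64 + + 8 * n ≡ + 72 * (1ℤ + n) - (+ 8 + + 64 * n)
    rewrite-slack = solve-∀

module _ {F : ℕ → ℤ} (F²≡1 : ∀ k → F k * F k ≡ 1ℤ) where

  ∣F∣≤1 : ∀ k → ∣ F k ∣ ℕ.≤ 1
  ∣F∣≤1 k with ∣ F k ∣ | ℤ.+-injective (trans (sym (i*i≡∣i∣² (F k))) (F²≡1 k))
  ... | 0       | ()
  ... | 1       | _  = ℕ.≤-refl
  ... | ℕ.suc (ℕ.suc _) | ()

  -- Let K be the sum over codes in base N. Both V - K and R - N ^ n are at most δ in size, the
  -- number of words with a repetition, which gives the factor 2. Moreover δ ≤ (n² / N) N ^ n = N ^
  -- n / M.
  carries-eulerian-near : ∀ M n .{{_ : NonZero M}} .{{_ : NonZero n}} .{{_ : NonZero (M ℕ.* (n ℕ.* n))}} →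
    let N = M ℕ.* (n ℕ.* n) in
    M ℕ.* ∣ + (n !) * ∑-digits N n (λ u → F (u ℕ./ N)) 0 - + (N ^ n) * ∑-code-descents n n F 0 0 ∣ ℕ.≤
    2 ℕ.* (n ! ℕ.* N ^ n)
  carries-eulerian-near M n = begin
    M ℕ.* ∣ + (n !) * V - + (N ^ n) * E ∣
      ≡⟨ cong (λ z → M ℕ.* ∣ z ∣) difference ⟩
    M ℕ.* ∣ + (n !) * (V - K) + (+ R - + (N ^ n)) * E ∣
      ≤⟨ ℕ.*-monoʳ-≤ M (ℕ.≤-trans (ℤ.∣i+j∣≤∣i∣+∣j∣ (+ (n !) * (V - K)) ((+ R - + (N ^ n)) * E))
           (ℕ.≤-reflexive (cong₂ ℕ._+_ (ℤ.abs-* (+ (n !)) (V - K)) (ℤ.abs-* (+ R - + (N ^ n)) E)))) ⟩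
    M ℕ.* (n ! ℕ.* ∣ V - K ∣ ℕ.+ ∣ + R - + (N ^ n) ∣ ℕ.* ∣ E ∣)
      ≤⟨ ℕ.*-monoʳ-≤ M (ℕ.+-mono-≤ (ℕ.*-monoʳ-≤ (n !) near) (ℕ.*-mono-≤ (ℕ.≤-reflexive gap) ∣E∣≤n!)) ⟩
    M ℕ.* (n ! ℕ.* δ ℕ.+ δ ℕ.* n !)
      ≡⟨ collect M (n !) δ ⟩
    2 ℕ.* (n ! ℕ.* (M ℕ.* δ))
      ≤⟨ ℕ.*-monoʳ-≤ 2 (ℕ.*-monoʳ-≤ (n !) M*δ≤Nⁿ) ⟩
    2 ℕ.* (n ! ℕ.* N ^ n)
      ∎
    where
    open ℕ.≤-Reasoning
    instance _ = ℕ.m*n≢0 n n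
    L = n ℕ.* n
    N = M ℕ.* L
    R = falling N n
    δ = N ^ n ℕ.∸ R
    V K E : ℤ
    V = ∑-digits N n (λ u → F (u ℕ./ N)) 0
    K = ∑-code-descents N n F 0 0
    E = ∑-code-descents n n F 0 0
    word-near : ∣ V - K ∣ ℕ.+ R ℕ.≤ N ^ n
    word-near = subst₂ (λ v m → ∣ v - K ∣ ℕ.+ R ℕ.≤ m ^ n)
      (sym (trans (carries-descents N n F 0 (ℕ.>-nonZero⁻¹ N)) (cong (λ m → ∑-word-descents m n F 0 0) (sym (ℕ.+-identityʳ N)))))
      (ℕ.+-identityʳ N)
      (word-code-near ∣F∣≤1 N 0 n 0 0)
    near : ∣ V - K ∣ ℕ.≤ δ
    near = ℕ.m+n≤o⇒m≤o∸n ∣ V - K ∣ word-near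
    R≤Nⁿ : R ℕ.≤ N ^ n
    R≤Nⁿ = ℕ.m+n≤o⇒n≤o ∣ V - K ∣ word-near
    gap : ∣ + R - + (N ^ n) ∣ ≡ δ
    gap = trans (cong ∣_∣ (ℤ.m-n≡m⊖n R (N ^ n))) (ℤ.∣⊖∣-≤ R≤Nⁿ)
    ∣E∣≤n! : ∣ E ∣ ℕ.≤ n !
    ∣E∣≤n! = subst (∣ E ∣ ℕ.≤_) (falling-self n) (∣code-descents∣ ∣F∣≤1 n n 0 0)
    n≤N : n ℕ.≤ N
    n≤N = ℕ.≤-trans (ℕ.m≤n*m n n) (ℕ.m≤n*m L M)
    scaling : K * + (n !) ≡ + R * E
    scaling = subst (λ m → ∑-code-descents m n F 0 0 * + (n !) ≡ + falling m n * E) (ℕ.m∸n+n≡m n≤N)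
      (code-descents-scaling (N ℕ.∸ n) n F)
    regroup : ∀ f v k p e r → k * f ≡ r * e → f * v - p * e ≡ f * (v - k) + (r - p) * e
    regroup f v k p e r eq = trans (expand f v k p e) (trans (cong (λ z → f * (v - k) + (z - p * e)) eq) (fold f v k p e r))
      where
      expand : ∀ f v k p e → f * v - p * e ≡ f * (v - k) + (k * f - p * e)
      expand = solve-∀
      fold : ∀ f v k p e r → f * (v - k) + (r * e - p * e) ≡ f * (v - k) + (r - p) * e
      fold = solve-∀
    difference : + (n !) * V - + (N ^ n) * E ≡ + (n !) * (V - K) + (+ R - + (N ^ n)) * E
    difference = regroup (+ (n !)) V K (+ (N ^ n)) E (+ R) scaling
    collect : ∀ M f d → M ℕ.* (f ℕ.* d ℕ.+ d ℕ.* f) ≡ 2 ℕ.* (f ℕ.* (M ℕ.* d))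
    collect = ℕSolver.solve-∀
    M*δ≤Nⁿ : M ℕ.* δ ℕ.≤ N ^ n
    M*δ≤Nⁿ = ℕ.*-cancelˡ-≤ L (begin
      L ℕ.* (M ℕ.* δ)                    ≡⟨ trans (sym (ℕ.*-assoc L M δ)) (cong (ℕ._* δ) (ℕ.*-comm L M)) ⟩
      N ℕ.* (N ^ n ℕ.∸ R)                ≡⟨ ℕ.*-distribˡ-∸ N (N ^ n) R ⟩
      N ℕ.* N ^ n ℕ.∸ N ℕ.* R            ≤⟨ ℕ.m≤n+o⇒m∸n≤o (N ℕ.* N ^ n) (N ℕ.* R) (subst (λ m → m ℕ.* m ^ n ℕ.≤ m ℕ.* R ℕ.+ L ℕ.* m ^ n) (ℕ.+-identityʳ N) (falling-near-power 0 N n)) ⟩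
      L ℕ.* N ^ n                        ∎)

  -- Y / μ is the difference of the expectations of F under the two laws; the bound on its size is
  -- √(72 n) / M.
  carries-eulerian : ∀ M n .{{_ : NonZero M}} → 2 ℕ.≤ M → 2 ℕ.≤ n →
    let Y = + (n !) * ∑-digits M n (λ u → F (u ℕ./ M)) 0 - + (M ^ n) * ∑-code-descents n n F 0 0
        μ = + (n !) * + (M ^ n)
    in + M * Y * (+ M * Y) ≤ + 72 * + n * (μ * μ)
  carries-eulerian M 1 2≤M (ℕ.s≤s ())
  -- The smoothing acts on the n - 1 digits left after telescoping, so n - 1 has to be positive too.
  carries-eulerian M n@(ℕ.suc n-1@(ℕ.suc _)) 2≤M 2≤n =
    subst (λ p → + M * (f * X - p * E) * (+ M * (f * X - p * E)) ≤ + 72 * + n * (f * p * (f * p)))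
      (sym (ℤ.pos-* M (M ^ n-1)))
      (combine-errors (+ n-1) (+ M) f (+ (M ^ n-1)) (+ (L ^ n)) V X E {{ℤ.positive (ℤ.+<+ (ℕ.m^n>0 L n))}} (ℤ.+≤+ ℕ.z≤n)
        (subst (λ q → + M * (f * V - q * E) * (+ M * (f * V - q * E)) ≤ + 2 * (f * q) * (+ 2 * (f * q))) power
          (subst₂ (λ c z → + M * z * (+ M * z) ≤ c * c) double refl
            (∣i∣≤c⇒i²≤c² {+ M * (f * V - + (N ^ n) * E)} {2 ℕ.* (n ! ℕ.* N ^ n)}
              (subst (ℕ._≤ 2 ℕ.* (n ! ℕ.* N ^ n)) (sym (ℤ.abs-* (+ M) (f * V - + (N ^ n) * E))) (carries-eulerian-near M n)))))
        (carries-near {n-1} {F} F²≡1 M L 2≤M))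
    where
    L = n ℕ.* n
    N = M ℕ.* L
    instance _ = ℕ.m*n≢0 M L
    f V X E : ℤ
    f = + (n !)
    V = ∑-digits N n (λ u → F (u ℕ./ N)) 0
    X = ∑-digits M n (λ u → F (u ℕ./ M)) 0
    E = ∑-code-descents n n F 0 0
    power : + (N ^ n) ≡ + (L ^ n) * (+ M * + (M ^ n-1))
    power = begin
      + ((M ℕ.* L) ^ n)                ≡⟨ cong +_ (^-distribʳ-* M L n) ⟩
      + (M ^ n ℕ.* L ^ n)              ≡⟨ cong +_ (ℕ.*-comm (M ^ n) (L ^ n)) ⟩
      + (L ^ n ℕ.* M ^ n)              ≡⟨ ℤ.pos-* (L ^ n) (M ^ n) ⟩
      + (L ^ n) * + (M ^ n)            ≡⟨ cong (+ (L ^ n) *_) (ℤ.pos-* M (M ^ n-1)) ⟩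
      + (L ^ n) * (+ M * + (M ^ n-1))  ∎
      where open ≡-Reasoning
    double : + (2 ℕ.* (n ! ℕ.* N ^ n)) ≡ + 2 * (f * + (N ^ n))
    double = trans (ℤ.pos-* 2 (n ! ℕ.* N ^ n)) (cong (+ 2 *_) (ℤ.pos-* (n !) (N ^ n)))

-- Arithmetic of fractions

toℚᵘ-/ : ∀ i n .{{_ : NonZero n}} → ℚ.toℚᵘ (i / n) ℚᵘ.≃ i ℚᵘ./ n
toℚᵘ-/ i (ℕ.suc n) = ℚ.toℚᵘ-fromℚᵘ (ℚᵘ.mkℚᵘ i n)

-- On unnormalised representatives this is an identity between cross products in ℤ.
+-/ : ∀ i j n .{{_ : NonZero n}} → i / n ℚ.+ j / n ≡ (i + j) / n
+-/ i j n@(ℕ.suc _) = ℚ.toℚᵘ-injective (begin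
  ℚ.toℚᵘ (i / n ℚ.+ j / n)            ≈⟨ ℚ.toℚᵘ-homo-+ (i / n) (j / n) ⟩
  ℚ.toℚᵘ (i / n) ℚᵘ.+ ℚ.toℚᵘ (j / n)  ≈⟨ ℚᵘ.+-cong (toℚᵘ-/ i n) (toℚᵘ-/ j n) ⟩
  i ℚᵘ./ n ℚᵘ.+ j ℚᵘ./ n              ≈⟨ ℚᵘ.*≡* (trans (lemma i j (+ n)) (cong ((i + j) *_) (sym (ℤ.pos-* n n)))) ⟩
  (i + j) ℚᵘ./ n                      ≈⟨ toℚᵘ-/ (i + j) n ⟨
  ℚ.toℚᵘ ((i + j) / n)                ∎)
  where
  open ℚᵘ.≃-Reasoning
  lemma : ∀ i j n → (i * n + j * n) * n ≡ (i + j) * (n * n)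
  lemma = solve-∀

∣-∣-/ : ∀ i j m n .{{_ : NonZero m}} .{{_ : NonZero n}} .{{_ : NonZero (m ℕ.* n)}} →
  ℚ.∣ i / m ℚ.- j / n ∣ ≡ + ∣ i * + n - j * + m ∣ / (m ℕ.* n)
∣-∣-/ i j m@(ℕ.suc _) n@(ℕ.suc _) = ℚ.toℚᵘ-injective (begin
  ℚ.toℚᵘ ℚ.∣ i / m ℚ.- j / n ∣
    ≈⟨ ℚ.toℚᵘ-homo-∣-∣ (i / m ℚ.- j / n) ⟩
  ℚᵘ.∣ ℚ.toℚᵘ (i / m ℚ.- j / n) ∣
    ≈⟨ ℚᵘ.∣-∣-cong (ℚᵘ.≃-trans (ℚ.toℚᵘ-homo-+ (i / m) (ℚ.- (j / n)))
         (ℚᵘ.+-cong (toℚᵘ-/ i m) (ℚᵘ.≃-trans (ℚ.toℚᵘ-homo‿- (j / n)) (ℚᵘ.-‿cong (toℚᵘ-/ j n))))) ⟩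
  ℚᵘ.∣ i ℚᵘ./ m ℚᵘ.- j ℚᵘ./ n ∣
    ≈⟨ ℚᵘ.*≡* (cong (λ k → + ∣ i * + n + k ∣ * + (m ℕ.* n)) (sym (ℤ.neg-distribˡ-* j (+ m)))) ⟩
  + ∣ i * + n - j * + m ∣ ℚᵘ./ (m ℕ.* n)
    ≈⟨ toℚᵘ-/ (+ ∣ i * + n - j * + m ∣) (m ℕ.* n) ⟨
  ℚ.toℚᵘ (+ ∣ i * + n - j * + m ∣ / (m ℕ.* n))
    ∎)
  where open ℚᵘ.≃-Reasoning

½*-/ : ∀ i n .{{_ : NonZero n}} .{{_ : NonZero (2 ℕ.* n)}} → ℚ.½ ℚ.* (i / n) ≡ i / (2 ℕ.* n)
½*-/ i n@(ℕ.suc _) = ℚ.toℚᵘ-injective (begin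
  ℚ.toℚᵘ (ℚ.½ ℚ.* (i / n))             ≈⟨ ℚ.toℚᵘ-homo-* ℚ.½ (i / n) ⟩
  ℚᵘ.½ ℚᵘ.* ℚ.toℚᵘ (i / n)             ≈⟨ ℚᵘ.*-congˡ {ℚᵘ.½} (toℚᵘ-/ i n) ⟩
  ℚᵘ.½ ℚᵘ.* (i ℚᵘ./ n)                 ≈⟨ ℚᵘ.*≡* (cong (_* + (2 ℕ.* n)) (ℤ.*-identityˡ i)) ⟩
  i ℚᵘ./ (2 ℕ.* n)                     ≈⟨ toℚᵘ-/ i (2 ℕ.* n) ⟨
  ℚ.toℚᵘ (i / (2 ℕ.* n))               ∎)
  where open ℚᵘ.≃-Reasoning

sum-/ : ∀ {n} d .{{_ : NonZero d}} (h : Fin n → ℚ) (c : ℕ → ℤ) → (∀ j → h j ≡ c (toℕ j) / d) → sum h ≡ ∑ (upTo n) c / d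
sum-/ {ℕ.zero}  d h c eq = ℚ.toℚᵘ-injective (ℚᵘ.≃-trans (ℚᵘ.*≡* (zero-eq d)) (ℚᵘ.≃-sym (toℚᵘ-/ 0ℤ d)))
  where
  zero-eq : ∀ d .{{_ : NonZero d}} → 0ℤ * ℚᵘ.↧ (0ℤ ℚᵘ./ d) ≡ ℚᵘ.↥ (0ℤ ℚᵘ./ d) * 1ℤ
  zero-eq (ℕ.suc d) = refl
sum-/ {ℕ.suc n} d h c eq = begin
  h Fin.zero ℚ.+ sum (h ∘ Fin.suc)             ≡⟨ cong₂ ℚ._+_ (eq Fin.zero) (sum-/ d (h ∘ Fin.suc) (c ∘ ℕ.suc) (eq ∘ Fin.suc)) ⟩
  c 0 / d ℚ.+ ∑ (upTo n) (c ∘ ℕ.suc) / d       ≡⟨ +-/ (c 0) (∑ (upTo n) (c ∘ ℕ.suc)) d ⟩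
  (c 0 + ∑ (upTo n) (c ∘ ℕ.suc)) / d           ≡⟨ cong (_/ d) (∑-upTo-suc n c) ⟨
  ∑ (upTo (ℕ.suc n)) c / d                     ∎
  where open ≡-Reasoning

-- Total variation and the final bound

sgn : ℤ → ℤ
-- The value at 0 is 1, so that the sign has square 1 everywhere.
sgn (+ _)    = 1ℤ
sgn -[1+ _ ] = - 1ℤ

sgn² : ∀ i → sgn i * sgn i ≡ 1ℤ
sgn² (+ _)    = refl
sgn² -[1+ _ ] = refl

sgn*i≡∣i∣ : ∀ i → sgn i * i ≡ + ∣ i ∣
sgn*i≡∣i∣ (+ n)    = ℤ.*-identityˡ (+ n)
sgn*i≡∣i∣ -[1+ n ] = cong (λ m → + ℕ.suc m) (ℕ.+-identityʳ n)

s²≤v²⇒s≤v : ∀ {s v} → 0ℚ ℚ.≤ v → s ℚ.* s ℚ.≤ v ℚ.* v → s ℚ.≤ v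
s²≤v²⇒s≤v {s} {v} 0≤v s²≤v² with s ℚ.≤? v
... | yes s≤v = s≤v
... | no  s≰v = contradiction refl (ℚ.<⇒≢ (ℚ.≤-<-trans s²≤v² (ℚ.≤-<-trans
    (ℚ.*-monoˡ-≤-nonNeg v {{ℚ.nonNegative 0≤v}} (ℚ.<⇒≤ v<s))
    (ℚ.*-monoˡ-<-pos s {{ℚ.positive (ℚ.≤-<-trans 0≤v v<s)}} v<s))))
  where
  v<s = ℚ.≰⇒> s≰v

-- F is the sign of the difference of the two laws at each point, brought to the common denominator
-- D. Summing the difference against F yields its absolute values.
total-variation : ∀ b .{{_ : NonZero b}} n .{{_ : NonZero n}} r .{{_ : NonZero (b ^ r)}} →
  let D = (b ^ r) ^ n ℕ.* n ! in .{{_ : NonZero (2 ℕ.* D)}} →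
  ∃[ F ] (∀ k → F k * F k ≡ 1ℤ) ×
    ‖ P₀ b n r - π n ‖TV ≡
      (+ (n !) * ∑-digits (b ^ r) n (λ u → F (u ℕ./ (b ^ r))) 0 - + ((b ^ r) ^ n) * ∑-code-descents n n F 0 0) / (2 ℕ.* D)
total-variation b n r = F , (λ k → sgn² (d k)) , (begin
  ℚ.½ ℚ.* sum (λ j → ℚ.∣ P₀ b n r j ℚ.- π n j ∣)
    ≡⟨ cong (ℚ.½ ℚ.*_) (sum-/ D (λ j → ℚ.∣ P₀ b n r j ℚ.- π n j ∣) (λ j → F j * d j) (λ j → trans
         (cong (λ x → ℚ.∣ x ℚ.- π n j ∣) (ℚ./-cong {p₁ = p (toℕ j)} refl Mⁿ))
         (trans (∣-∣-/ (p (toℕ j)) (+ A n (toℕ j)) ((b ^ r) ^ n) (n !))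
           (cong (_/ D) (sym (sgn*i≡∣i∣ (d (toℕ j)))))))) ⟩
  ℚ.½ ℚ.* ((∑[ j ∈ upTo n ] F j * d j) / D)
    ≡⟨ ½*-/ (∑[ j ∈ upTo n ] F j * d j) D ⟩
  (∑[ j ∈ upTo n ] F j * d j) / (2 ℕ.* D)
    ≡⟨ cong (_/ (2 ℕ.* D)) difference ⟩
  (+ (n !) * ∑-digits (b ^ r) n (λ u → F (u ℕ./ (b ^ r))) 0 - + ((b ^ r) ^ n) * ∑-code-descents n n F 0 0) / (2 ℕ.* D)
    ∎)
  where
  open ≡-Reasoning
  D = (b ^ r) ^ n ℕ.* n !
  instance
    _ = n ℕ.!≢0
    _ = ℕ.m^n≢0 (b ^ r) n
    _ = ℕ.m^n≢0 b (n ℕ.* r)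
    _ = ℕ.m*n≢0 ((b ^ r) ^ n) (n !)
  p d F : ℕ → ℤ
  p j = + count (λ xs → κ b xs ℕ.≟ j) (words (words (allFin b) n) r)
  d j = p j * + (n !) - + A n j * + ((b ^ r) ^ n)
  F j = sgn (d j)
  Mⁿ : b ^ (n ℕ.* r) ≡ (b ^ r) ^ n
  Mⁿ = trans (cong (b ^_) (ℕ.*-comm n r)) (sym (ℕ.^-*-assoc b r n))
  distrib : ∀ s p f a m → s * (p * f - a * m) ≡ f * (s * p) - m * (s * a)
  distrib = solve-∀
  difference : (∑[ j ∈ upTo n ] F j * d j) ≡
    + (n !) * ∑-digits (b ^ r) n (λ u → F (u ℕ./ (b ^ r))) 0 - + ((b ^ r) ^ n) * ∑-code-descents n n F 0 0
  difference = begin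
    (∑[ j ∈ upTo n ] F j * d j)
      ≡⟨ ∑-cong (upTo n) (λ j → distrib (F j) (p j) (+ (n !)) (+ A n j) (+ ((b ^ r) ^ n))) ⟩
    (∑[ j ∈ upTo n ] + (n !) * (F j * p j) - + ((b ^ r) ^ n) * (F j * + A n j))
      ≡⟨ ∑-- (upTo n) (λ j → + (n !) * (F j * p j)) (λ j → + ((b ^ r) ^ n) * (F j * + A n j)) ⟩
    (∑[ j ∈ upTo n ] + (n !) * (F j * p j)) - (∑[ j ∈ upTo n ] + ((b ^ r) ^ n) * (F j * + A n j))
      ≡⟨ cong₂ _-_
           (trans (∑-*ˡ (+ (n !)) (upTo n) (λ j → F j * p j)) (cong (+ (n !) *_) (∑-carries b n r F)))
           (trans (∑-*ˡ (+ ((b ^ r) ^ n)) (upTo n) (λ j → F j * + A n j)) (cong (+ ((b ^ r) ^ n) *_) (∑-eulerian n F))) ⟩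
    + (n !) * ∑-digits (b ^ r) n (λ u → F (u ℕ./ (b ^ r))) 0 - + ((b ^ r) ^ n) * ∑-code-descents n n F 0 0
      ∎

-- The denominator 2 D reduces 72 to 72 / 4 = 18, and 5 is the least integer whose square is at
-- least 18. The slack 28 is 4 · 25 - 72.
fraction-bound : ∀ Y M n D .{{_ : NonZero n}} .{{_ : NonZero (2 ℕ.* D)}} →
  + M * Y * (+ M * Y) ≤ + 72 * + n * (+ D * + D) →
  let s = Y / (2 ℕ.* D) in s ℚ.* s ℚ.* (+ (M ℕ.* M) / n) ℚ.≤ + 5 / 1 ℚ.* (+ 5 / 1)
fraction-bound Y M n@(ℕ.suc _) D@(ℕ.suc _) bound = ℚ.toℚᵘ-cancel-≤ (begin
  ℚ.toℚᵘ (s ℚ.* s ℚ.* (+ (M ℕ.* M) / n))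
    ≃⟨ ℚᵘ.≃-trans (ℚ.toℚᵘ-homo-* (s ℚ.* s) (+ (M ℕ.* M) / n))
         (ℚᵘ.*-cong (ℚᵘ.≃-trans (ℚ.toℚᵘ-homo-* s s) (ℚᵘ.*-cong (toℚᵘ-/ Y (2 ℕ.* D)) (toℚᵘ-/ Y (2 ℕ.* D)))) (toℚᵘ-/ (+ (M ℕ.* M)) n)) ⟩
  Y ℚᵘ./ (2 ℕ.* D) ℚᵘ.* (Y ℚᵘ./ (2 ℕ.* D)) ℚᵘ.* (+ (M ℕ.* M) ℚᵘ./ n)
    ≤⟨ ℚᵘ.*≤* cross ⟩
  ℚ.toℚᵘ (+ 5 / 1 ℚ.* (+ 5 / 1))
    ∎)
  where
  open ℚᵘ.≤-Reasoning
  s = Y / (2 ℕ.* D)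
  E = 2 ℕ.* D
  regroup : ∀ Y m → Y * Y * (m * m) * 1ℤ ≡ m * Y * (m * Y)
  regroup = solve-∀
  enlarge : ∀ n d → + 72 * n * (d * d) + + 28 * (n * (d * d)) ≡ + 25 * (+ 2 * d * (+ 2 * d) * n)
  enlarge = solve-∀
  slack≥0 : 0ℤ ≤ + 28 * (+ n * (+ D * + D))
  slack≥0 = subst (0ℤ ≤_) (trans (ℤ.pos-* 28 (n ℕ.* (D ℕ.* D))) (cong (+ 28 *_) (trans (ℤ.pos-* n (D ℕ.* D)) (cong (+ n *_) (ℤ.pos-* D D))))) (ℤ.+≤+ ℕ.z≤n)
  cross : Y * Y * + (M ℕ.* M) * 1ℤ ≤ + 25 * + (E ℕ.* E ℕ.* n)
  cross = ℤ.≤-trans (ℤ.≤-reflexive (trans (cong (λ m → Y * Y * m * 1ℤ) (ℤ.pos-* M M)) (regroup Y (+ M))))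
    (ℤ.≤-trans bound (ℤ.≤-trans
      (subst (_≤ + 72 * + n * (+ D * + D) + + 28 * (+ n * (+ D * + D))) (ℤ.+-identityʳ _)
        (ℤ.+-monoʳ-≤ (+ 72 * + n * (+ D * + D)) slack≥0))
      (ℤ.≤-reflexive (trans (enlarge (+ n) (+ D)) (cong (+ 25 *_) (sym
        (trans (ℤ.pos-* (E ℕ.* E) n) (cong (_* + n) (trans (ℤ.pos-* E E) (cong (λ e → e * e) (ℤ.pos-* 2 D)))))))))))

total-variation-bound : ∀ n b r .{{_ : NonZero n}} .{{_ : NonZero b}} → n ≥ 2 → b ≥ 2 → r ≥ 1 →
  let t = ‖ P₀ b n r - π n ‖TV in t ℚ.* t ℚ.* (+ (b ^ (2 ℕ.* r)) / n) ℚ.≤ + 5 / 1 ℚ.* (+ 5 / 1)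
total-variation-bound n b r n≥2 b≥2 r≥1 =
  let F , F²≡1 , tv = total-variation b n r
      Y = + (n !) * ∑-digits M n (λ u → F (u ℕ./ M)) 0 - + (M ^ n) * ∑-code-descents n n F 0 0
  in subst₂ (λ t m → t ℚ.* t ℚ.* (+ m / n) ℚ.≤ + 5 / 1 ℚ.* (+ 5 / 1)) (sym tv) M²
       (fraction-bound Y M n (M ^ n ℕ.* n !)
         (subst (λ μ → + M * Y * (+ M * Y) ≤ + 72 * + n * (μ * μ)) μ≡D (carries-eulerian F²≡1 M n M≥2 n≥2)))
  where
  M = b ^ r
  instance
    _ = ℕ.m^n≢0 b r
    _ = ℕ.m^n≢0 M n
    _ = n ℕ.!≢0
    _ = ℕ.m*n≢0 (M ^ n) (n !)
    _ = ℕ.m*n≢0 2 (M ^ n ℕ.* n !)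
  M≥2 : M ≥ 2
  M≥2 = ℕ.≤-trans b≥2 (subst (ℕ._≤ M) (ℕ.*-identityʳ b) (ℕ.^-monoʳ-≤ b r≥1))
  M² : M ℕ.* M ≡ b ^ (2 ℕ.* r)
  M² = trans (sym (ℕ.^-distribˡ-+-* b r r)) (cong (λ k → b ^ (r ℕ.+ k)) (sym (ℕ.+-identityʳ r)))
  μ≡D : + (n !) * + (M ^ n) ≡ + (M ^ n ℕ.* n !)
  μ≡D = trans (ℤ.*-comm (+ (n !)) (+ (M ^ n))) (sym (ℤ.pos-* (M ^ n) (n !)))

theorem3p4 : ∃[ B ] (B > 0ℚ ×
    (∀ (n b r : ℕ) .{{_ : NonZero n}} .{{_ : NonZero b}} →
    n ≥ 2 → b ≥ 2 → r ≥ 1 →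
    let c = + (b ^ (2 ℕ.* r)) / n in
    c > 1ℚ →
    ‖ P₀ b n r - π n ‖TV ≤ᵣ B /√ (+ n / 1) ⊕ B /√ c))
theorem3p4 = + 5 / 1 , ℚ.positive⁻¹ (+ 5 / 1) , bound
  where
  bound : ∀ (n b r : ℕ) .{{_ : NonZero n}} .{{_ : NonZero b}} → n ≥ 2 → b ≥ 2 → r ≥ 1 →
    let c = + (b ^ (2 ℕ.* r)) / n in c > 1ℚ →
    ‖ P₀ b n r - π n ‖TV ≤ᵣ + 5 / 1 /√ (+ n / 1) ⊕ + 5 / 1 /√ c
  -- With t the distance, t² c ≤ B² ≤ v² c gives t ≤ v after cancelling c > 0, and v ≤ u + v because
  -- 0 ≤ u.
  bound n b r n≥2 b≥2 r≥1 c>1 w (u , v , (0≤u , _) , (0≤v , B²≤v²c) , refl) = ℚ.≤-trans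
    (s²≤v²⇒s≤v 0≤v (ℚ.*-cancelʳ-≤-pos c {{ℚ.positive (ℚ.<-trans (ℚ.positive⁻¹ 1ℚ) c>1)}}
      (ℚ.≤-trans (total-variation-bound n b r n≥2 b≥2 r≥1) B²≤v²c)))
    (subst (ℚ._≤ u ℚ.+ v) (ℚ.+-identityˡ v) (ℚ.+-monoˡ-≤ v 0≤u))
    where c = + (b ^ (2 ℕ.* r)) / n
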